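{- Let $\mathcal A$ be a well-structured abstract domain, and let monotone abstract operators $\llbracket e\rrbracket^\#:\mathcal A\to\mathcal A$ be given for each basic command $e$, extended inductively to all programs as described in the context. (1) If $\llbracket e\rrbracket^\#$ is a sound abstraction of $\llbracket e\rrbracket$ for every basic command $e$, then $\llbracket S\rrbracket^\#$ is a sound abstraction of $\llbracket S\rrbracket$ for every program $S$. (2) If $\llbracket e\rrbracket^\#$ is a complete abstraction of $\llbracket e\rrbracket$ for every basic command $e$, then $\llbracket S\rrbracket^\#$ is a complete abstraction of $\llbracket S\rrbracket$ for every program $S$.
   Context: Fix a finite set $V$ of quantum variables, each a qubit with state space $\mathcal H_q\cong\mathbb C^2$; for $W\subseteq V$, $\mathcal H_W=\bigotimes_{q\in W}\mathcal H_q$. Operators and subspaces on $\mathcal H_W$ are identified with their cylindrical extensions to $\mathcal H_V$, and a subspace is identified with its orthogonal projector; $P^\perp$ is the orthocomplement. $\mathcal D(\mathcal H_V)$ is the set of partial density operators (positive, trace $\le1$). Programs: $S::=\mathbf{skip}\mid \bar q:=|0\rangle\mid \bar q\mathrel{*{=}}U\mid \mathbf{assert}\ P[\bar q]\mid S_0;S_1\mid \mathbf{if}\ P[\bar q]\ \mathbf{then}\ S_1\ \mathbf{else}\ S_0\ \mathbf{end}\mid\mathbf{while}\ P[\bar q]\ \mathbf{do}\ S\ \mathbf{end}$, with $\bar q=q_1,\dots,q_t$ distinct variables, $U$ unitary on $\mathcal H_{\bar q}$, $P$ a subspace of $\mathcal H_{\bar q}$; the first four forms are the basic commands. Semantics $\llbracket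 S\rrbracket:\mathcal D(\mathcal H_V)\to\mathcal D(\mathcal H_V)$: $\llbracket\mathbf{skip}\rrbracket(\rho)=\rho$; $\llbracket\bar q:=|0\rangle\rrbracket(\rho)=\sum_{i=0}^{2^t-1}|0\rangle_{\bar q}\langle i|\rho|i\rangle_{\bar q}\langle0|$; $\llbracket\bar q\mathrel{*{=}}U\rrbracket(\rho)=U\rho U^\dagger$; $\llbracket\mathbf{assert}\ P[\bar q]\rrbracket(\rho)=P\rho P$; $\llbracket S_0;S_1\rrbracket=\llbracket S_1\rrbracket\circ\llbracket S_0\rrbracket$; $\llbracket\mathbf{if}\ P[\bar q]\ \mathbf{then}\ S_1\ \mathbf{else}\ S_0\ \mathbf{end}\rrbracket(\rho)=\llbracket\mathbf{assert}\ P[\bar q];S_1\rrbracket(\rho)+\llbracket\mathbf{assert}\ P^\perp[\bar q];S_0\rrbracket(\rho)$; $\llbracket\mathbf{while}\ P[\bar q]\ \mathbf{do}\ S\ \mathbf{end}\rrbracket(\rho)=\sum_{i\ge0}\llbracket(\mathbf{assert}\ P[\bar q];S)^i;\mathbf{assert}\ P^\perp[\bar q]\rrbracket(\rho)$, where $T^i$ is $i$-fold sequential composition ($T^0=\mathbf{skip}$). The concrete domain is $\mathcal Q=2^{\mathcal D(\mathcal H_V)}$ ordered by inclusion, and $\llbracket S\rrbracket(R)=\{\llbracket S\rrbracket(\rho):\rho\in R\}$. A pair of monotone maps $(\alpha,\gamma)$ between posets is a Galois connection if $c\le\gamma(a)\iff\alpha(c)\le a$, and a Galois embedding if moreover $\alpha\circ\gamma=\mathrm{id}$.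 A complete lattice $(\mathcal A,\le_{\mathcal A},\vee,\wedge,\bot,\top)$ with monotone $\alpha:\mathcal Q\to\mathcal A$, $\gamma:\mathcal A\to\mathcal Q$ is a well-structured abstract domain if (a) $(\alpha,\gamma)$ is a Galois embedding, and (b) for any family $\rho_i\in\mathcal D(\mathcal H_V)$ and reals $x_i>0$ with $\sum_i x_i\rho_i\in\mathcal D(\mathcal H_V)$, $\alpha(\sum_i x_i\rho_i)=\bigvee_i\alpha(\rho_i)$, where $\alpha(\rho)=\alpha(\{\rho\})$. For $f:\mathcal Q\to\mathcal Q$, an operator $f^\#:\mathcal A\to\mathcal A$ is a sound abstraction of $f$ if $\alpha(f(R))\le_{\mathcal A}f^\#(\alpha(R))$ for all $R\in\mathcal Q$, and a complete abstraction if equality holds for all $R$. Given monotone $\llbracket e\rrbracket^\#$ for basic commands $e$, the operators $\llbracket S\rrbracket^\#$ for composite programs are defined inductively: $\llbracket S_0;S_1\rrbracket^\#=\llbracket S_1\rrbracket^\#\circ\llbracket S_0\rrbracket^\#$; $\llbracket\mathbf{if}\ P[\bar q]\ \mathbf{then}\ S_1\ \mathbf{else}\ S_0\ \mathbf{end}\rrbracket^\#(a)=\llbracket\mathbf{assert}\ P[\bar q];S_1\rrbracket^\#(a)\vee\llbracket\mathbf{assert}\ P^\perp[\bar q];S_0\rrbracket^\#(a)$; $\llbracket\mathbf{while}\ P[\bar q]\ \mathbf{do}\ S\ \mathbf{end}\rrbracket^\#(a)=\bigvee_{i\ge0}\llbracket(\mathbf{assert}\ P[\bar q];S)^i;\mathbf{assert}\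 P^\perp[\bar q]\rrbracket^\#(a)$. -}

module Defs where

open import Level using (0ℓ; _⊔_) renaming (suc to lsuc)
open import Data.Bool.Base using (Bool; true; false; if_then_else_)
import Data.Bool.Properties as Bool
open import Data.Empty using (⊥-elim)
open import Data.Fin.Base using (Fin; zero; suc)
import Data.Fin.Properties as Fin
open import Data.Integer.Base as ℤ using (ℤ; +_; -[1+_])
import Data.Integer.Properties as ℤ
open import Data.Maybe.Base using (just; nothing)
open import Data.Nat.Base as ℕ using (ℕ; zero; suc)
import Data.Nat.Properties as ℕ
open import Data.Product.Base using (∃; _×_; _,_; proj₁; proj₂)
open import Data.Sum.Base using (inj₁; inj₂)
open import Data.Vec.Base using (Vec; []; _∷_; lookup; map; replicate; _[_]≔_)
import Data.Vec.Properties as Vec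
open import Data.Vec.Relation.Unary.Any using (here; there)
open import Data.Vec.Relation.Unary.All using (All; []; _∷_)
open import Data.Vec.Relation.Unary.AllPairs using ([]; _∷_)
import Data.Vec.Relation.Unary.Unique.Propositional as Unique
import Data.Vec.Membership.Propositional as Membership
import Data.Vec.Membership.DecPropositional as DecMembership
open import Function.Base using (_∘_; id)
open import Function.Bundles using (_⇔_)
open import Algebra.Bundles using (CommutativeRing)
open import Algebra.Structures using (IsCommutativeRing)
import Algebra.Properties.Ring
import Algebra.Properties.AbelianGroup
import Algebra.Properties.Semiring.Mult
import Algebra.Properties.CommutativeMonoid.Sum
import Algebra.Solver.Ring
import Algebra.Solver.Ring.AlmostCommutativeRing as ACR
open import Axiom.ExcludedMiddle using (ExcludedMiddle)
open import Relation.Binary.Core using (Rel; _Preserves_⟶_)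
open import Relation.Binary.Bundles using (Setoid; Poset)
open import Relation.Binary.Definitions using (WeaklyDecidable)
open import Relation.Binary.Structures using (IsTotalOrder)
open import Relation.Binary.Lattice.Bundles using (BoundedLattice)
open import Relation.Binary.PropositionalEquality as ≡ using (_≡_; _≢_)
import Relation.Binary.Reasoning.Setoid
open import Relation.Nullary using (¬_; Dec; yes; no; does)
open import Relation.Nullary.Decidable using (¬?; _→-dec_)
open import Relation.Unary using (Pred)

-- ℝ enters through its axioms as a (Dedekind-)complete ordered field,
-- which determine it up to isomorphism.

record CompleteOrderedField : Set₁ where
  infix 4 _≤_ _<_
  field
    commutativeRing : CommutativeRing 0ℓ 0ℓ

  open CommutativeRing commutativeRing public

  field
    _≤_          : Rel Carrier 0ℓ
    isTotalOrder : IsTotalOrder _≈_ _≤_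
    0≉1          : ¬ (0# ≈ 1#)
    inverse      : ∀ x → ¬ (x ≈ 0#) → ∃ λ y → x * y ≈ 1#
    +-monoˡ-≤    : ∀ z {x y} → x ≤ y → x + z ≤ y + z
    *-nonNeg     : ∀ {x y} → 0# ≤ x → 0# ≤ y → 0# ≤ x * y

  IsUpperBound : Pred Carrier 0ℓ → Carrier → Set
  IsUpperBound P b = ∀ {x} → P x → x ≤ b

  field
    supremum : (P : Pred Carrier 0ℓ) → ∃ P → ∃ (IsUpperBound P) →
               ∃ λ s → IsUpperBound P s × (∀ b → IsUpperBound P b → s ≤ b)

  _<_ : Rel Carrier 0ℓ
  x < y = ¬ (y ≤ x)

module RingSolver (R : CommutativeRing 0ℓ 0ℓ) where
  open CommutativeRing R
  open Algebra.Properties.Ring ring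
  open Algebra.Properties.AbelianGroup +-abelianGroup using (⁻¹-∙-comm)
  open Algebra.Properties.Semiring.Mult semiring using (×-homo-+; ×1-homo-*) renaming (_×_ to _·_)
  open Relation.Binary.Reasoning.Setoid setoid

  ⟦_⟧ᶻ : ℤ → Carrier
  ⟦ + n ⟧ᶻ      = n · 1#
  ⟦ -[1+ n ] ⟧ᶻ = - (suc n · 1#)

  neg-homo : ∀ i → ⟦ ℤ.- i ⟧ᶻ ≈ - ⟦ i ⟧ᶻ
  neg-homo (+ zero)   = sym -0#≈0#
  neg-homo (+ suc n)  = refl
  neg-homo -[1+ n ]   = sym (-‿involutive _)

  ⊖-homo : ∀ m n → ⟦ m ℤ.⊖ n ⟧ᶻ ≈ m · 1# - n · 1#
  ⊖-homo m zero = begin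
    ⟦ m ℤ.⊖ 0 ⟧ᶻ   ≡⟨ ≡.cong ⟦_⟧ᶻ (ℤ.⊖-≥ {m} ℕ.z≤n) ⟩
    m · 1#        ≈⟨ +-identityʳ _ ⟨
    m · 1# + 0#   ≈⟨ +-congˡ -0#≈0# ⟨
    m · 1# - 0#   ∎
  ⊖-homo zero (suc n) = sym (+-identityˡ _)
  ⊖-homo (suc m) (suc n) = begin
    ⟦ suc m ℤ.⊖ suc n ⟧ᶻ                  ≡⟨ ≡.cong ⟦_⟧ᶻ (ℤ.[1+m]⊖[1+n]≡m⊖n m n) ⟩
    ⟦ m ℤ.⊖ n ⟧ᶻ                          ≈⟨ ⊖-homo m n ⟩
    m · 1# - n · 1#                       ≈⟨ +-congʳ (+-identityʳ _) ⟨
    m · 1# + 0# - n · 1#                  ≈⟨ +-congʳ (+-congˡ (-‿inverseʳ 1#)) ⟨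
    m · 1# + (1# - 1#) - n · 1#           ≈⟨ +-congʳ (+-assoc _ _ _) ⟨
    m · 1# + 1# - 1# - n · 1#             ≈⟨ +-assoc _ _ _ ⟩
    m · 1# + 1# + (- 1# - n · 1#)         ≈⟨ +-cong (+-comm _ _) (⁻¹-∙-comm _ _) ⟩
    suc m · 1# - suc n · 1#               ∎

  add-homo : ∀ i j → ⟦ i ℤ.+ j ⟧ᶻ ≈ ⟦ i ⟧ᶻ + ⟦ j ⟧ᶻ
  add-homo (+ m)    (+ n)    = ×-homo-+ 1# m n
  add-homo (+ m)    -[1+ n ] = ⊖-homo m (suc n)
  add-homo -[1+ m ] (+ n)    = trans (⊖-homo n (suc m)) (+-comm _ _)
  add-homo -[1+ m ] -[1+ n ] = begin
    - (suc (suc (m ℕ.+ n)) · 1#)          ≡⟨ ≡.cong (λ k → - (suc k · 1#)) (≡.sym (ℕ.+-suc m n)) ⟩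
    - ((suc m ℕ.+ suc n) · 1#)            ≈⟨ -‿cong (×-homo-+ 1# (suc m) (suc n)) ⟩
    - (suc m · 1# + suc n · 1#)           ≈⟨ ⁻¹-∙-comm _ _ ⟨
    - (suc m · 1#) - suc n · 1#           ∎

  mul-homo⁺ : ∀ m j → ⟦ + m ℤ.* j ⟧ᶻ ≈ ⟦ + m ⟧ᶻ * ⟦ j ⟧ᶻ
  mul-homo⁺ m (+ n) = trans (reflexive (≡.cong ⟦_⟧ᶻ (≡.sym (ℤ.pos-* m n)))) (×1-homo-* m n)
  mul-homo⁺ m -[1+ n ] = begin
    ⟦ + m ℤ.* ℤ.- (+ suc n) ⟧ᶻ       ≡⟨ ≡.cong ⟦_⟧ᶻ (≡.sym (ℤ.neg-distribʳ-* (+ m) (+ suc n))) ⟩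
    ⟦ ℤ.- (+ m ℤ.* + suc n) ⟧ᶻ       ≈⟨ neg-homo (+ m ℤ.* + suc n) ⟩
    - ⟦ + m ℤ.* + suc n ⟧ᶻ           ≈⟨ -‿cong (mul-homo⁺ m (+ suc n)) ⟩
    - (⟦ + m ⟧ᶻ * (suc n · 1#))      ≈⟨ -‿distribʳ-* _ _ ⟩
    ⟦ + m ⟧ᶻ * - (suc n · 1#)        ∎

  mul-homo : ∀ i j → ⟦ i ℤ.* j ⟧ᶻ ≈ ⟦ i ⟧ᶻ * ⟦ j ⟧ᶻ
  mul-homo (+ m) j = mul-homo⁺ m j
  mul-homo -[1+ m ] j = begin
    ⟦ ℤ.- (+ suc m) ℤ.* j ⟧ᶻ         ≡⟨ ≡.cong ⟦_⟧ᶻ (≡.sym (ℤ.neg-distribˡ-* (+ suc m) j)) ⟩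
    ⟦ ℤ.- (+ suc m ℤ.* j) ⟧ᶻ         ≈⟨ neg-homo (+ suc m ℤ.* j) ⟩
    - ⟦ + suc m ℤ.* j ⟧ᶻ             ≈⟨ -‿cong (mul-homo⁺ (suc m) j) ⟩
    - (⟦ + suc m ⟧ᶻ * ⟦ j ⟧ᶻ)        ≈⟨ -‿distribˡ-* _ _ ⟩
    - ⟦ + suc m ⟧ᶻ * ⟦ j ⟧ᶻ          ∎

  -- The same map, with 1# rather than 1# + 0# as the image of 1, so that
  -- the constant 1 in a solved equation is literally 1#.
  ⟦_⟧ᶜ : ℤ → Carrier
  ⟦ + 1 ⟧ᶜ = 1#
  ⟦ i ⟧ᶜ   = ⟦ i ⟧ᶻ

  ⟦⟧ᶜ≈⟦⟧ᶻ : ∀ i → ⟦ i ⟧ᶜ ≈ ⟦ i ⟧ᶻ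
  ⟦⟧ᶜ≈⟦⟧ᶻ (+ 0)           = refl
  ⟦⟧ᶜ≈⟦⟧ᶻ (+ 1)           = sym (+-identityʳ 1#)
  ⟦⟧ᶜ≈⟦⟧ᶻ (+ suc (suc _)) = refl
  ⟦⟧ᶜ≈⟦⟧ᶻ -[1+ _ ]        = refl

  morphism : ℤ.+-*-rawRing ACR.-Raw-AlmostCommutative⟶ ACR.fromCommutativeRing R
  morphism = record
    { ⟦_⟧    = ⟦_⟧ᶜ
    ; +-homo = λ i j → trans (⟦⟧ᶜ≈⟦⟧ᶻ (i ℤ.+ j))
                         (trans (add-homo i j) (sym (+-cong (⟦⟧ᶜ≈⟦⟧ᶻ i) (⟦⟧ᶜ≈⟦⟧ᶻ j))))
    ; *-homo = λ i j → trans (⟦⟧ᶜ≈⟦⟧ᶻ (i ℤ.* j))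
                         (trans (mul-homo i j) (sym (*-cong (⟦⟧ᶜ≈⟦⟧ᶻ i) (⟦⟧ᶜ≈⟦⟧ᶻ j))))
    ; -‿homo = λ i → trans (⟦⟧ᶜ≈⟦⟧ᶻ (ℤ.- i)) (trans (neg-homo i) (sym (-‿cong (⟦⟧ᶜ≈⟦⟧ᶻ i))))
    ; 0-homo = refl
    ; 1-homo = refl
    }

  _coeff≟_ : WeaklyDecidable (ACR.Induced-equivalence morphism)
  i coeff≟ j with i ℤ.≟ j
  ... | yes i≡j = just (reflexive (≡.cong ⟦_⟧ᶜ i≡j))
  ... | no _    = nothing

  open Algebra.Solver.Ring ℤ.+-*-rawRing (ACR.fromCommutativeRing R) morphism _coeff≟_ public
    using (solve; _:=_; _:+_; _:*_; _:-_; :-_; con)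

  :0 :1 : ∀ {m} → Algebra.Solver.Ring.Polynomial ℤ.+-*-rawRing (ACR.fromCommutativeRing R) morphism _coeff≟_ m
  :0 = con (+ 0)
  :1 = con (+ 1)

module RealAnalysis (em : ExcludedMiddle 0ℓ) (ℝ : CompleteOrderedField) where
  open CompleteOrderedField ℝ
  open RingSolver commutativeRing
  open IsTotalOrder isTotalOrder public
    using (total; antisym; ≤-respˡ-≈; ≤-respʳ-≈)
    renaming (refl to ≤-refl; trans to ≤-trans; reflexive to ≤-reflexive)
  open Algebra.Properties.Ring ring using (-0#≈0#; -‿involutive)

  infix 4 _⟶_

  _⟶_ : (ℕ → Carrier) → Carrier → Set
  s ⟶ l = ∀ ε → 0# < ε → ∃ λ N → ∀ n → N ℕ.≤ n → l - ε ≤ s n × s n ≤ l + ε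

  partialSum : (ℕ → Carrier) → ℕ → Carrier
  partialSum s zero    = 0#
  partialSum s (suc n) = partialSum s n + s n

  ≤-resp : ∀ {x x′ y y′} → x ≈ x′ → y ≈ y′ → x ≤ y → x′ ≤ y′
  ≤-resp p q x≤y = ≤-respˡ-≈ p (≤-respʳ-≈ q x≤y)

  0≤⇒≤ : ∀ {x y} → 0# ≤ y - x → x ≤ y
  0≤⇒≤ {x} {y} p = ≤-resp (+-identityˡ x)
    (solve 2 (λ x y → y :- x :+ x := y) refl x y) (+-monoˡ-≤ x p)

  ≤⇒0≤ : ∀ {x y} → x ≤ y → 0# ≤ y - x
  ≤⇒0≤ {x} p = ≤-respˡ-≈ (-‿inverseʳ x) (+-monoˡ-≤ (- x) p)

  +-mono-≤ : ∀ {x y u v} → x ≤ y → u ≤ v → x + u ≤ y + v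
  +-mono-≤ {x} {y} {u} {v} p q = ≤-trans (+-monoˡ-≤ u p)
    (≤-resp (+-comm u y) (+-comm v y) (+-monoˡ-≤ y q))

  neg-mono-≤ : ∀ {x y} → x ≤ y → - y ≤ - x
  neg-mono-≤ {x} {y} p = 0≤⇒≤ (≤-respʳ-≈ (solve 2 (λ x y → y :- x := :- x :- (:- y)) refl x y) (≤⇒0≤ p))

  *-monoˡ-≤ : ∀ {c x y} → 0# ≤ c → x ≤ y → c * x ≤ c * y
  *-monoˡ-≤ {c} {x} {y} 0≤c p = 0≤⇒≤
    (≤-respʳ-≈ (solve 3 (λ c x y → c :* (y :- x) := c :* y :- c :* x) refl c x y) (*-nonNeg 0≤c (≤⇒0≤ p)))

  0≤+ : ∀ {x y} → 0# ≤ x → 0# ≤ y → 0# ≤ x + y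
  0≤+ p q = ≤-respˡ-≈ (+-identityˡ 0#) (+-mono-≤ p q)

  <⇒≤ : ∀ {x y} → x < y → x ≤ y
  <⇒≤ {x} {y} p with total x y
  ... | inj₁ q = q
  ... | inj₂ q = ⊥-elim (p q)

  ≮⇒≥ : ∀ {x y} → ¬ (x < y) → y ≤ x
  ≮⇒≥ {x} {y} p with em {y ≤ x}
  ... | yes q = q
  ... | no  q = ⊥-elim (p q)

  double-cancel-≤ : ∀ {x y} → x + x ≤ y + y → x ≤ y
  double-cancel-≤ {x} {y} p with total x y
  ... | inj₁ q = q
  ... | inj₂ q = ≤-resp (solve 2 (λ x y → x :+ x :- x := x) refl x y)
                        (solve 2 (λ x y → y :+ x :- x := y) refl x y)
                        (+-monoˡ-≤ (- x) (≤-trans p (+-mono-≤ ≤-refl q)))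

  -- Here and below, abstract and opaque serve only to keep type checking
  -- and unification from unfolding terms.

  abstract
    0≤1 : 0# ≤ 1#
    0≤1 with total 0# 1#
    ... | inj₁ p = p
    ... | inj₂ p = ≤-respʳ-≈ (solve 0 (:- :1 :* :- :1 := :1) refl) (*-nonNeg q q)
      where
      q : 0# ≤ - 1#
      q = ≤-respˡ-≈ -0#≈0# (neg-mono-≤ p)

  0<1 : 0# < 1#
  0<1 p = 0≉1 (antisym 0≤1 p)

  0<+ : ∀ {x y} → 0# < x → 0# ≤ y → 0# < x + y
  0<+ {x} {y} p q r = p (≤-trans (≤-resp (+-identityʳ x) refl (+-mono-≤ ≤-refl q)) r)

  0<⇒≉0 : ∀ {x} → 0# < x → ¬ (x ≈ 0#)
  0<⇒≉0 p q = p (≤-reflexive q)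

  abstract
    divide : ∀ {c ε} → 0# < c → 0# < ε → ∃ λ δ → 0# < δ × c * δ ≈ ε
    divide {c} {ε} 0<c 0<ε with inverse c (0<⇒≉0 0<c)
    ... | c⁻¹ , cc⁻¹≈1 = c⁻¹ * ε , 0<δ , cδ≈ε
      where
      cδ≈ε : c * (c⁻¹ * ε) ≈ ε
      cδ≈ε = trans (sym (*-assoc c c⁻¹ ε)) (trans (*-congʳ cc⁻¹≈1) (*-identityˡ ε))
      0<δ : 0# < c⁻¹ * ε
      0<δ p = 0<ε (≤-resp cδ≈ε (zeroʳ c) (*-monoˡ-≤ (<⇒≤ 0<c) p))

  2>0 : 0# < 1# + 1#
  2>0 = 0<+ 0<1 0≤1

  abstract
    halve : ∀ {ε} → 0# < ε → ∃ λ δ → 0# < δ × δ + δ ≈ ε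
    halve 0<ε = let (δ , 0<δ , eq) = divide 2>0 0<ε in δ , 0<δ , trans (double δ) eq
      where
      double : ∀ d → d + d ≈ (1# + 1#) * d
      double = solve 1 (λ d → d :+ d := (:1 :+ :1) :* d) refl

  ⟶-cong : ∀ {s t l m} → (∀ n → s n ≈ t n) → l ≈ m → s ⟶ l → t ⟶ m
  ⟶-cong s≈t l≈m s⟶l ε 0<ε with s⟶l ε 0<ε
  ... | N , h = N , λ n N≤n → ≤-resp (+-congʳ l≈m) (s≈t n) (proj₁ (h n N≤n)) ,
                              ≤-resp (s≈t n) (+-congʳ l≈m) (proj₂ (h n N≤n))

  ⟶-const : ∀ c → (λ _ → c) ⟶ c
  ⟶-const c ε 0<ε = 0 , λ _ _ →
    0≤⇒≤ (≤-respʳ-≈ (solve 2 (λ c e → e := c :- (c :- e)) refl c ε) (<⇒≤ 0<ε)) ,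
    0≤⇒≤ (≤-respʳ-≈ (solve 2 (λ c e → e := c :+ e :- c) refl c ε) (<⇒≤ 0<ε))

  ⟶-+ : ∀ {s t l m} → s ⟶ l → t ⟶ m → (λ n → s n + t n) ⟶ (l + m)
  ⟶-+ {s} {t} {l} {m} s⟶l t⟶m ε 0<ε with halve 0<ε
  ... | δ , 0<δ , δ+δ≈ε with s⟶l δ 0<δ | t⟶m δ 0<δ
  ... | M , h | N , k = M ℕ.⊔ N , λ n p →
    let hn = h n (ℕ.≤-trans (ℕ.m≤m⊔n M N) p)
        kn = k n (ℕ.≤-trans (ℕ.m≤n⊔m M N) p)
    in ≤-respˡ-≈ (trans (lower l m δ) (+-congˡ (-‿cong δ+δ≈ε))) (+-mono-≤ (proj₁ hn) (proj₁ kn)) ,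
       ≤-respʳ-≈ (trans (upper l m δ) (+-congˡ δ+δ≈ε)) (+-mono-≤ (proj₂ hn) (proj₂ kn))
    where
    lower : ∀ l m d → (l - d) + (m - d) ≈ l + m - (d + d)
    lower = solve 3 (λ l m d → (l :- d) :+ (m :- d) := l :+ m :- (d :+ d)) refl
    upper : ∀ l m d → (l + d) + (m + d) ≈ l + m + (d + d)
    upper = solve 3 (λ l m d → (l :+ d) :+ (m :+ d) := l :+ m :+ (d :+ d)) refl

  ⟶-neg : ∀ {s l} → s ⟶ l → (λ n → - s n) ⟶ (- l)
  ⟶-neg {s} {l} s⟶l ε 0<ε with s⟶l ε 0<ε
  ... | N , h = N , λ n p →
    ≤-respˡ-≈ (solve 2 (λ l e → :- (l :+ e) := :- l :- e) refl l ε) (neg-mono-≤ (proj₂ (h n p))) ,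
    ≤-respʳ-≈ (solve 2 (λ l e → :- (l :- e) := :- l :+ e) refl l ε) (neg-mono-≤ (proj₁ (h n p)))

  ⟶-*⁺ : ∀ {c s l} → 0# ≤ c → s ⟶ l → (λ n → c * s n) ⟶ (c * l)
  ⟶-*⁺ {c} {s} {l} 0≤c s⟶l ε 0<ε with divide (0<+ 0<1 0≤c) 0<ε
  ... | δ , 0<δ , eq with s⟶l δ 0<δ
  ... | N , h = N , λ n p →
    ≤-trans (0≤⇒≤ (≤-respʳ-≈ (trans (lower c δ l) (+-congˡ (-‿cong (+-congˡ (-‿cong eq))))) slack))
            (*-monoˡ-≤ 0≤c (proj₁ (h n p))) ,
    ≤-trans (*-monoˡ-≤ 0≤c (proj₂ (h n p)))
            (0≤⇒≤ (≤-respʳ-≈ (trans (upper c δ l) (+-congʳ (+-congˡ eq))) slack))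
    where
    lower : ∀ c d l → (1# + c) * d - c * d ≈ c * (l - d) - (c * l - (1# + c) * d)
    lower = solve 3 (λ c d l → (:1 :+ c) :* d :- c :* d := c :* (l :- d) :- (c :* l :- (:1 :+ c) :* d)) refl
    upper : ∀ c d l → (1# + c) * d - c * d ≈ (c * l + (1# + c) * d) - c * (l + d)
    upper = solve 3 (λ c d l → (:1 :+ c) :* d :- c :* d := (c :* l :+ (:1 :+ c) :* d) :- c :* (l :+ d)) refl
    slack : 0# ≤ (1# + c) * δ - c * δ
    slack = ≤-respʳ-≈ (solve 2 (λ c d → d := (:1 :+ c) :* d :- c :* d) refl c δ) (<⇒≤ 0<δ)

  ⟶-* : ∀ {s l} c → s ⟶ l → (λ n → c * s n) ⟶ (c * l)
  ⟶-* {s} {l} c s⟶l with total 0# c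
  ... | inj₁ 0≤c = ⟶-*⁺ 0≤c s⟶l
  ... | inj₂ c≤0 = ⟶-cong (λ n → eq (s n)) (eq l)
                     (⟶-neg (⟶-*⁺ (≤-respˡ-≈ -0#≈0# (neg-mono-≤ c≤0)) s⟶l))
    where
    eq : ∀ x → - (- c * x) ≈ c * x
    eq x = solve 2 (λ c x → :- (:- c :* x) := c :* x) refl c x

  ⟶-≤ : ∀ {s l b} → s ⟶ l → (∀ n → s n ≤ b) → l ≤ b
  ⟶-≤ {s} {l} {b} s⟶l s≤b = ≮⇒≥ λ b<l → absurd b<l
    where
    absurd : ¬ (b < l)
    absurd b<l with halve {l - b} (λ p → b<l (≤-resp (solve 2 (λ l b → l :- b :+ b := l) refl l b) (+-identityˡ b) (+-monoˡ-≤ b p)))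
    ... | δ , 0<δ , δ+δ≈l-b with s⟶l δ 0<δ
    ... | N , h = 0<δ (≤-resp (solve 1 (λ d → d :+ d :- d := d) refl δ) (-‿inverseʳ δ) (+-monoˡ-≤ (- δ) 2δ≤δ))
      where
      regroup : ∀ l b d → l - d + (d - b) ≈ l - b
      regroup = solve 3 (λ l b d → l :- d :+ (d :- b) := l :- b) refl
      2δ≤δ : δ + δ ≤ δ
      2δ≤δ = ≤-resp (trans (regroup l b δ) (sym δ+δ≈l-b))
                    (solve 2 (λ b d → b :+ (d :- b) := d) refl b δ)
                    (+-monoˡ-≤ (δ - b) (≤-trans (proj₁ (h N ℕ.≤-refl)) (s≤b N)))

  ⟶-≥ : ∀ {s l b} → s ⟶ l → (∀ n → b ≤ s n) → b ≤ l
  ⟶-≥ s⟶l b≤s = ≤-resp (-‿involutive _) (-‿involutive _)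
    (neg-mono-≤ (⟶-≤ (⟶-neg s⟶l) λ n → neg-mono-≤ (b≤s n)))

  ⟶-unique : ∀ {s l m} → s ⟶ l → s ⟶ m → l ≈ m
  ⟶-unique {s} {l} {m} p q = antisym (0≤⇒≤ (⟶-≥ (diff p q) λ n → ≤-reflexive (sym (-‿inverseʳ (s n)))))
                                     (0≤⇒≤ (⟶-≥ (diff q p) λ n → ≤-reflexive (sym (-‿inverseʳ (s n)))))
    where
    diff : ∀ {l m} → s ⟶ l → s ⟶ m → (λ n → s n - s n) ⟶ (m - l)
    diff p q = ⟶-+ q (⟶-neg p)

  monotone-converges : ∀ s b → (∀ n → s n ≤ s (suc n)) → (∀ n → s n ≤ b) → ∃ λ l → s ⟶ l
  monotone-converges s b step bound
    with supremum (λ x → ∃ λ n → x ≈ s n) (s 0 , 0 , refl)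
                  (b , λ (n , x≈sn) → ≤-respˡ-≈ (sym x≈sn) (bound n))
  ... | l , upper , least = l , converges
    where
    mono : ∀ {m n} → m ℕ.≤′ n → s m ≤ s n
    mono ℕ.≤′-refl       = ≤-refl
    mono (ℕ.≤′-step m≤n) = ≤-trans (mono m≤n) (step _)

    converges : s ⟶ l
    converges ε 0<ε with em {∃ λ N → l - ε ≤ s N}
    ... | yes (N , p) = N , λ n N≤n →
          ≤-trans p (mono (ℕ.≤⇒≤′ N≤n)) ,
          ≤-trans (upper (n , refl))
                  (0≤⇒≤ (≤-respʳ-≈ (solve 2 (λ l e → e := l :+ e :- l) refl l ε) (<⇒≤ 0<ε)))
    ... | no ¬p = ⊥-elim (0<ε (≤-resp (solve 2 (λ l e → l :+ (e :- l) := e) refl l ε)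
                                     (solve 2 (λ l e → l :- e :+ (e :- l) := :0) refl l ε)
                                     (+-monoˡ-≤ (ε - l) (least (l - ε) isUpper))))
      where
      isUpper : IsUpperBound (λ x → ∃ λ n → x ≈ s n) (l - ε)
      isUpper (n , x≈sn) = ≤-respˡ-≈ (sym x≈sn) (<⇒≤ λ q → ¬p (n , q))

  partialSum-+ : ∀ s t n → partialSum (λ i → s i + t i) n ≈ partialSum s n + partialSum t n
  partialSum-+ s t zero    = sym (+-identityˡ 0#)
  partialSum-+ s t (suc n) = trans (+-congʳ (partialSum-+ s t n))
    (solve 4 (λ a b c d → (a :+ b) :+ (c :+ d) := (a :+ c) :+ (b :+ d)) refl _ _ _ _)

  partialSum-mono : ∀ {s t} → (∀ i → s i ≤ t i) → ∀ n → partialSum s n ≤ partialSum t n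
  partialSum-mono p zero    = ≤-refl
  partialSum-mono p (suc n) = +-mono-≤ (partialSum-mono p n) (p n)

  nonNeg-series : ∀ s b → (∀ i → 0# ≤ s i) → (∀ n → partialSum s n ≤ b) → ∃ λ l → partialSum s ⟶ l
  nonNeg-series s b 0≤s = monotone-converges (partialSum s) b
    λ n → ≤-respˡ-≈ (+-identityʳ _) (+-mono-≤ ≤-refl (0≤s n))

  dominated-series : ∀ s t b → (∀ i → s i ≤ t i) → (∀ i → - t i ≤ s i) →
                     (∀ n → partialSum t n ≤ b) → ∃ λ l → partialSum s ⟶ l
  dominated-series s t b s≤t -t≤s bound
    with nonNeg-series (λ i → s i + t i) (b + b) 0≤s+t bound′ | nonNeg-series t b 0≤t bound
    where
    0≤s+t : ∀ i → 0# ≤ s i + t i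
    0≤s+t i = ≤-respˡ-≈ (-‿inverseˡ (t i)) (+-monoˡ-≤ (t i) (-t≤s i))
    0≤t : ∀ i → 0# ≤ t i
    0≤t i = double-cancel-≤ (≤-respˡ-≈ (sym (+-identityˡ 0#)) (≤-trans (0≤s+t i) (+-monoˡ-≤ (t i) (s≤t i))))
    bound′ : ∀ n → partialSum (λ i → s i + t i) n ≤ b + b
    bound′ n = ≤-respˡ-≈ (sym (partialSum-+ s t n)) (+-mono-≤ (≤-trans (partialSum-mono s≤t n) (bound n)) (bound n))
  ... | l , p | m , q = l - m , ⟶-cong eq refl (⟶-+ p (⟶-neg q))
    where
    eq : ∀ n → partialSum (λ i → s i + t i) n - partialSum t n ≈ partialSum s n
    eq n = trans (+-congʳ (partialSum-+ s t n)) (solve 2 (λ a b → a :+ b :- b := a) refl _ _)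

module Complex (em : ExcludedMiddle 0ℓ) (ℝ : CompleteOrderedField) where
  private
    module ℝ = CompleteOrderedField ℝ
    module A = RealAnalysis em ℝ
  open RingSolver ℝ.commutativeRing

  infix 5 _+i_

  record ℂ : Set where
    constructor _+i_
    field re im : ℝ.Carrier
  open ℂ public

  record _≈ᶜ_ (z w : ℂ) : Set where
    constructor _,_
    field
      re≈ : re z ℝ.≈ re w
      im≈ : im z ℝ.≈ im w
  open _≈ᶜ_ public

  opaque
    addᶜ mulᶜ : ℂ → ℂ → ℂ
    addᶜ (a +i b) (c +i d) = (a ℝ.+ c) +i (b ℝ.+ d)
    mulᶜ (a +i b) (c +i d) = (a ℝ.* c ℝ.- b ℝ.* d) +i (a ℝ.* d ℝ.+ b ℝ.* c)

    negᶜ conj : ℂ → ℂ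
    negᶜ (a +i b) = (ℝ.- a) +i (ℝ.- b)
    conj (a +i b) = a +i (ℝ.- b)

  fromℝ : ℝ.Carrier → ℂ
  fromℝ a = a +i ℝ.0#

  opaque
    unfolding addᶜ
    isCommutativeRingᶜ : IsCommutativeRing _≈ᶜ_ addᶜ mulᶜ negᶜ (fromℝ ℝ.0#) (fromℝ ℝ.1#)
    isCommutativeRingᶜ = record
      { isRing = record
        { +-isAbelianGroup = record
          { isGroup = record
            { isMonoid = record
              { isSemigroup = record
                { isMagma = record
                  { isEquivalence = record
                    { refl  = ℝ.refl , ℝ.refl
                    ; sym   = λ p → ℝ.sym (re≈ p) , ℝ.sym (im≈ p)
                    ; trans = λ p q → ℝ.trans (re≈ p) (re≈ q) , ℝ.trans (im≈ p) (im≈ q)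
                    }
                  ; ∙-cong = λ p q → ℝ.+-cong (re≈ p) (re≈ q) , ℝ.+-cong (im≈ p) (im≈ q)
                  }
                ; assoc = λ x y z → ℝ.+-assoc _ _ _ , ℝ.+-assoc _ _ _
                }
              ; identity = (λ x → ℝ.+-identityˡ _ , ℝ.+-identityˡ _) ,
                           (λ x → ℝ.+-identityʳ _ , ℝ.+-identityʳ _)
              }
            ; inverse = (λ x → ℝ.-‿inverseˡ _ , ℝ.-‿inverseˡ _) ,
                        (λ x → ℝ.-‿inverseʳ _ , ℝ.-‿inverseʳ _)
            ; ⁻¹-cong = λ p → ℝ.-‿cong (re≈ p) , ℝ.-‿cong (im≈ p)
            }
          ; comm = λ x y → ℝ.+-comm _ _ , ℝ.+-comm _ _
          }
        ; *-cong = λ p q →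
            ℝ.+-cong (ℝ.*-cong (re≈ p) (re≈ q)) (ℝ.-‿cong (ℝ.*-cong (im≈ p) (im≈ q))) ,
            ℝ.+-cong (ℝ.*-cong (re≈ p) (im≈ q)) (ℝ.*-cong (im≈ p) (re≈ q))
        ; *-assoc = λ x y z →
            solve 6 (λ a b c d e f → (a :* c :- b :* d) :* e :- (a :* d :+ b :* c) :* f
                                  := a :* (c :* e :- d :* f) :- b :* (c :* f :+ d :* e))
                    ℝ.refl (re x) (im x) (re y) (im y) (re z) (im z) ,
            solve 6 (λ a b c d e f → (a :* c :- b :* d) :* f :+ (a :* d :+ b :* c) :* e
                                  := a :* (c :* f :+ d :* e) :+ b :* (c :* e :- d :* f))
                    ℝ.refl (re x) (im x) (re y) (im y) (re z) (im z)
        ; *-identity = (λ x → solve 2 (λ a b → :1 :* a :- :0 :* b := a) ℝ.refl (re x) (im x) ,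
                              solve 2 (λ a b → :1 :* b :+ :0 :* a := b) ℝ.refl (re x) (im x)) ,
                       (λ x → solve 2 (λ a b → a :* :1 :- b :* :0 := a) ℝ.refl (re x) (im x) ,
                              solve 2 (λ a b → a :* :0 :+ b :* :1 := b) ℝ.refl (re x) (im x))
        ; distrib = (λ x y z →
            solve 6 (λ a b c d e f → a :* (c :+ e) :- b :* (d :+ f)
                                  := (a :* c :- b :* d) :+ (a :* e :- b :* f))
                    ℝ.refl (re x) (im x) (re y) (im y) (re z) (im z) ,
            solve 6 (λ a b c d e f → a :* (d :+ f) :+ b :* (c :+ e)
                                  := (a :* d :+ b :* c) :+ (a :* f :+ b :* e))
                    ℝ.refl (re x) (im x) (re y) (im y) (re z) (im z)) ,
                    (λ x y z →
            solve 6 (λ a b c d e f → (c :+ e) :* a :- (d :+ f) :* b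
                                  := (c :* a :- d :* b) :+ (e :* a :- f :* b))
                    ℝ.refl (re x) (im x) (re y) (im y) (re z) (im z) ,
            solve 6 (λ a b c d e f → (c :+ e) :* b :+ (d :+ f) :* a
                                  := (c :* b :+ d :* a) :+ (e :* b :+ f :* a))
                    ℝ.refl (re x) (im x) (re y) (im y) (re z) (im z))
        }
      ; *-comm = λ x y →
          solve 4 (λ a b c d → a :* c :- b :* d := c :* a :- d :* b) ℝ.refl (re x) (im x) (re y) (im y) ,
          solve 4 (λ a b c d → a :* d :+ b :* c := c :* b :+ d :* a) ℝ.refl (re x) (im x) (re y) (im y)
      }

  commutativeRingᶜ : CommutativeRing 0ℓ 0ℓ
  commutativeRingᶜ = record { isCommutativeRing = isCommutativeRingᶜ }

  infix 4 _≤ᶜ_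

  record _≤ᶜ_ (z w : ℂ) : Set where
    constructor _,_
    field
      re≤ : re z ℝ.≤ re w
      im≡ : im z ℝ.≈ im w
  open _≤ᶜ_ public

  infix 4 _⟶ᶜ_

  record _⟶ᶜ_ (s : ℕ → ℂ) (l : ℂ) : Set where
    constructor _,_
    field
      re⟶ : (re ∘ s) A.⟶ re l
      im⟶ : (im ∘ s) A.⟶ im l
  open _⟶ᶜ_ public

  open CommutativeRing commutativeRingᶜ

  opaque
    unfolding addᶜ
    conj-cong : ∀ {z w} → z ≈ w → conj z ≈ conj w
    conj-cong p = re≈ p , ℝ.-‿cong (im≈ p)

    conj-+ : ∀ z w → conj (z + w) ≈ conj z + conj w
    conj-+ z w = ℝ.refl , solve 2 (λ a b → :- (a :+ b) := :- a :+ :- b) ℝ.refl (im z) (im w)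

    conj-* : ∀ z w → conj (z * w) ≈ conj z * conj w
    conj-* z w =
      solve 4 (λ a b c d → a :* c :- b :* d := a :* c :- :- b :* :- d) ℝ.refl (re z) (im z) (re w) (im w) ,
      solve 4 (λ a b c d → :- (a :* d :+ b :* c) := a :* :- d :+ :- b :* c) ℝ.refl (re z) (im z) (re w) (im w)

    conj-neg : ∀ z → conj (- z) ≈ - conj z
    conj-neg z = refl

    conj-conj : ∀ z → conj (conj z) ≈ z
    conj-conj z = ℝ.refl , solve 1 (λ a → :- (:- a) := a) ℝ.refl (im z)

    conj-fromℝ : ∀ a → conj (fromℝ a) ≈ fromℝ a
    conj-fromℝ a = ℝ.refl , solve 0 (:- :0 := :0) ℝ.refl

    ≤ᶜ-reflexive : ∀ {z w} → z ≈ w → z ≤ᶜ w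
    ≤ᶜ-reflexive p = A.≤-reflexive (re≈ p) , im≈ p

    ≤ᶜ-refl : ∀ {z} → z ≤ᶜ z
    ≤ᶜ-refl = A.≤-refl , ℝ.refl

    ≤ᶜ-trans : ∀ {x y z} → x ≤ᶜ y → y ≤ᶜ z → x ≤ᶜ z
    ≤ᶜ-trans p q = A.≤-trans (re≤ p) (re≤ q) , ℝ.trans (im≡ p) (im≡ q)

    ≤ᶜ-resp : ∀ {x x′ y y′} → x ≈ x′ → y ≈ y′ → x ≤ᶜ y → x′ ≤ᶜ y′
    ≤ᶜ-resp p q x≤y = ≤ᶜ-trans (≤ᶜ-reflexive (sym p)) (≤ᶜ-trans x≤y (≤ᶜ-reflexive q))

    +ᶜ-mono-≤ : ∀ {x y u v} → x ≤ᶜ y → u ≤ᶜ v → x + u ≤ᶜ y + v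
    +ᶜ-mono-≤ p q = A.+-mono-≤ (re≤ p) (re≤ q) , ℝ.+-cong (im≡ p) (im≡ q)

    0≤ᶜ+ : ∀ {x y} → 0# ≤ᶜ x → 0# ≤ᶜ y → 0# ≤ᶜ x + y
    0≤ᶜ+ p q = ≤ᶜ-resp (+-identityˡ 0#) refl (+ᶜ-mono-≤ p q)

    ≤ᶜ-+ʳ : ∀ {x y} → 0# ≤ᶜ y → x ≤ᶜ x + y
    ≤ᶜ-+ʳ p = ≤ᶜ-resp (+-identityʳ _) refl (+ᶜ-mono-≤ ≤ᶜ-refl p)

    ≤ᶜ-+ˡ : ∀ {x y} → 0# ≤ᶜ x → y ≤ᶜ x + y
    ≤ᶜ-+ˡ p = ≤ᶜ-resp (+-identityˡ _) refl (+ᶜ-mono-≤ p ≤ᶜ-refl)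

    ⟶ᶜ-cong : ∀ {s t l m} → (∀ n → s n ≈ t n) → l ≈ m → s ⟶ᶜ l → t ⟶ᶜ m
    ⟶ᶜ-cong p q r = A.⟶-cong (re≈ ∘ p) (re≈ q) (re⟶ r) , A.⟶-cong (im≈ ∘ p) (im≈ q) (im⟶ r)

    ⟶ᶜ-0 : (λ _ → 0#) ⟶ᶜ 0#
    ⟶ᶜ-0 = A.⟶-const ℝ.0# , A.⟶-const ℝ.0#

    ⟶ᶜ-+ : ∀ {s t l m} → s ⟶ᶜ l → t ⟶ᶜ m → (λ n → s n + t n) ⟶ᶜ (l + m)
    ⟶ᶜ-+ p q = A.⟶-+ (re⟶ p) (re⟶ q) , A.⟶-+ (im⟶ p) (im⟶ q)

    ⟶ᶜ-* : ∀ {s l} c → s ⟶ᶜ l → (λ n → c * s n) ⟶ᶜ (c * l)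
    ⟶ᶜ-* c p = A.⟶-+ (A.⟶-* (re c) (re⟶ p)) (A.⟶-neg (A.⟶-* (im c) (im⟶ p))) ,
               A.⟶-+ (A.⟶-* (re c) (im⟶ p)) (A.⟶-* (im c) (re⟶ p))

    ⟶ᶜ-unique : ∀ {s l m} → s ⟶ᶜ l → s ⟶ᶜ m → l ≈ m
    ⟶ᶜ-unique p q = A.⟶-unique (re⟶ p) (re⟶ q) , A.⟶-unique (im⟶ p) (im⟶ q)

    ⟶ᶜ-≥ : ∀ {s l b} → s ⟶ᶜ l → (∀ n → b ≤ᶜ s n) → b ≤ᶜ l
    ⟶ᶜ-≥ {b = b} p h = A.⟶-≥ (re⟶ p) (re≤ ∘ h) ,
      A.⟶-unique (A.⟶-const (im b)) (A.⟶-cong (λ n → ℝ.sym (im≡ (h n))) ℝ.refl (im⟶ p))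

    ⟶ᶜ-≤ : ∀ {s l b} → s ⟶ᶜ l → (∀ n → s n ≤ᶜ b) → l ≤ᶜ b
    ⟶ᶜ-≤ {b = b} p h = A.⟶-≤ (re⟶ p) (re≤ ∘ h) ,
      ℝ.sym (A.⟶-unique (A.⟶-const (im b)) (A.⟶-cong (λ n → im≡ (h n)) ℝ.refl (im⟶ p)))

-- The basis of (ℂ²)^⊗t is indexed by the bit strings of length t.
Bits : ℕ → Set
Bits = Vec Bool

module Matrices (em : ExcludedMiddle 0ℓ) (ℝ : CompleteOrderedField) where
  open Complex em ℝ public
  open CommutativeRing commutativeRingᶜ public
    using (_≈_; _+_; _*_; -_; _-_; 0#; 1#; refl; sym; trans; reflexive; setoid;
           +-cong; +-congˡ; +-congʳ; +-identityˡ; +-identityʳ; +-comm; +-assoc; -‿inverseʳ;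
           *-cong; *-congˡ; *-congʳ; *-identityˡ; *-identityʳ; *-comm; *-assoc; zeroˡ; zeroʳ;
           distribˡ; distribʳ; -‿cong; ring; +-commutativeMonoid)
  open RingSolver commutativeRingᶜ
  open Relation.Binary.Reasoning.Setoid setoid

  opaque
    ∑ : ∀ {t} → (Bits t → ℂ) → ℂ
    ∑ {zero}  f = f []
    ∑ {suc t} f = ∑ (λ x → f (false ∷ x)) + ∑ (λ x → f (true ∷ x))

  𝟙 : ∀ {p} {P : Set p} → Dec P → ℂ
  𝟙 d = if does d then 1# else 0#

  _≟ᵇ_ : ∀ {t} (x y : Bits t) → Dec (x ≡ y)
  _≟ᵇ_ = Vec.≡-dec Bool._≟_

  Ket : ℕ → Set
  Ket t = Bits t → ℂ

  Matrix : ℕ → Set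
  Matrix t = Bits t → Bits t → ℂ

  infix 4 _≈ᴹ_ _≟ᵇ_

  record _≈ᴹ_ {t} (M N : Matrix t) : Set where
    constructor entrywise
    field at : ∀ x y → M x y ≈ N x y
  open _≈ᴹ_ public

  infixl 6 _+ᴹ_ _-ᴹ_
  infixl 7 _∙_
  infixr 5 _$ᴷ_
  infixr 7 _·ᴹ_
  infix  8 _†

  _+ᴹ_ _-ᴹ_ _∙_ : ∀ {t} → Matrix t → Matrix t → Matrix t
  (M +ᴹ N) x y = M x y + N x y
  (M -ᴹ N) x y = M x y - N x y
  (M ∙ N) x y  = ∑ λ z → M x z * N z y

  _·ᴹ_ : ∀ {t} → ℂ → Matrix t → Matrix t
  (c ·ᴹ M) x y = c * M x y

  0ᴹ Iᴹ : ∀ {t} → Matrix t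
  0ᴹ x y = 0#
  Iᴹ x y = 𝟙 (x ≟ᵇ y)

  _† : ∀ {t} → Matrix t → Matrix t
  (M †) x y = conj (M y x)

  tr : ∀ {t} → Matrix t → ℂ
  tr M = ∑ λ x → M x x

  ∑ᴹ : ∀ {s t} → (Bits s → Matrix t) → Matrix t
  ∑ᴹ M x y = ∑ λ i → M i x y

  _$ᴷ_ : ∀ {t} → Matrix t → Ket t → Ket t
  (M $ᴷ v) x = ∑ λ y → M x y * v y

  ⟨_∣_⟩ : ∀ {t} → Ket t → Ket t → ℂ
  ⟨ u ∣ v ⟩ = ∑ λ x → conj (u x) * v x

  ket : ∀ {t} → Bits t → Ket t
  ket i x = 𝟙 (i ≟ᵇ x)

  ∣_⟩⟨_∣ : ∀ {t} → Ket t → Ket t → Matrix t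
  ∣ u ⟩⟨ v ∣ x y = u x * conj (v y)

  Positive : ∀ {t} → Matrix t → Set
  Positive M = ∀ v → 0# ≤ᶜ ⟨ v ∣ M $ᴷ v ⟩

  opaque
    unfolding ∑

    ∑-cong : ∀ {t} {f g : Bits t → ℂ} → (∀ x → f x ≈ g x) → ∑ f ≈ ∑ g
    ∑-cong {zero}  p = p []
    ∑-cong {suc t} p = +-cong (∑-cong (p ∘ (false ∷_))) (∑-cong (p ∘ (true ∷_)))

    interchange : ∀ a b c d → (a + b) + (c + d) ≈ (a + c) + (b + d)
    interchange = solve 4 (λ a b c d → (a :+ b) :+ (c :+ d) := (a :+ c) :+ (b :+ d)) refl

    ∑-+ : ∀ {t} (f g : Bits t → ℂ) → ∑ (λ x → f x + g x) ≈ ∑ f + ∑ g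
    ∑-+ {zero}  f g = refl
    ∑-+ {suc t} f g = trans (+-cong (∑-+ (f ∘ (false ∷_)) (g ∘ (false ∷_))) (∑-+ (f ∘ (true ∷_)) (g ∘ (true ∷_)))) (interchange _ _ _ _)

    ∑-0 : ∀ {t} → ∑ {t} (λ _ → 0#) ≈ 0#
    ∑-0 {zero}  = refl
    ∑-0 {suc t} = trans (+-cong (∑-0 {t}) (∑-0 {t})) (+-identityˡ 0#)

    ∑-*ˡ : ∀ {t} c (f : Bits t → ℂ) → ∑ (λ x → c * f x) ≈ c * ∑ f
    ∑-*ˡ {zero}  c f = refl
    ∑-*ˡ {suc t} c f = trans (+-cong (∑-*ˡ c (f ∘ (false ∷_))) (∑-*ˡ c (f ∘ (true ∷_)))) (sym (distribˡ c _ _))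

  ∑-*ʳ : ∀ {t} c (f : Bits t → ℂ) → ∑ (λ x → f x * c) ≈ ∑ f * c
  ∑-*ʳ c f = trans (∑-cong λ x → *-comm (f x) c) (trans (∑-*ˡ c f) (*-comm c _))

  opaque
    unfolding ∑

    ∑-swap : ∀ {s t} (f : Bits s → Bits t → ℂ) → ∑ (λ x → ∑ (f x)) ≈ ∑ (λ y → ∑ (λ x → f x y))
    ∑-swap {zero}  f = refl
    ∑-swap {suc s} f = trans (+-cong (∑-swap (f ∘ (false ∷_))) (∑-swap (f ∘ (true ∷_)))) (sym (∑-+ (λ y → ∑ (λ x → f (false ∷ x) y)) (λ y → ∑ (λ x → f (true ∷ x) y))))

    conj-∑ : ∀ {t} (f : Bits t → ℂ) → conj (∑ f) ≈ ∑ (conj ∘ f)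
    conj-∑ {zero}  f = refl
    conj-∑ {suc t} f = trans (conj-+ _ _) (+-cong (conj-∑ (f ∘ (false ∷_))) (conj-∑ (f ∘ (true ∷_))))

    ∑-nonNeg : ∀ {t} {f : Bits t → ℂ} → (∀ x → 0# ≤ᶜ f x) → 0# ≤ᶜ ∑ f
    ∑-nonNeg {zero}  p = p []
    ∑-nonNeg {suc t} p = 0≤ᶜ+ (∑-nonNeg (p ∘ (false ∷_))) (∑-nonNeg (p ∘ (true ∷_)))

    ∑-term-≤ : ∀ {t} {f : Bits t → ℂ} → (∀ x → 0# ≤ᶜ f x) → ∀ x → f x ≤ᶜ ∑ f
    ∑-term-≤ p [] = ≤ᶜ-refl
    ∑-term-≤ p (false ∷ x) = ≤ᶜ-trans (∑-term-≤ (p ∘ (false ∷_)) x) (≤ᶜ-+ʳ (∑-nonNeg (p ∘ (true ∷_))))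
    ∑-term-≤ p (true ∷ x)  = ≤ᶜ-trans (∑-term-≤ (p ∘ (true ∷_)) x) (≤ᶜ-+ˡ (∑-nonNeg (p ∘ (false ∷_))))

    ∑-⟶ : ∀ {t} {s : ℕ → Bits t → ℂ} {l : Bits t → ℂ} →
          (∀ x → (λ n → s n x) ⟶ᶜ l x) → (λ n → ∑ (s n)) ⟶ᶜ ∑ l
    ∑-⟶ {zero}  p = p []
    ∑-⟶ {suc t} p = ⟶ᶜ-+ (∑-⟶ (p ∘ (false ∷_))) (∑-⟶ (p ∘ (true ∷_)))

  𝟙-⇔ : ∀ {p q} {P : Set p} {Q : Set q} (d : Dec P) (e : Dec Q) → (P → Q) → (Q → P) → 𝟙 d ≈ 𝟙 e
  𝟙-⇔ (yes p) (yes q) f g = refl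
  𝟙-⇔ (yes p) (no ¬q) f g = ⊥-elim (¬q (f p))
  𝟙-⇔ (no ¬p) (yes q) f g = ⊥-elim (¬p (g q))
  𝟙-⇔ (no ¬p) (no ¬q) f g = refl

  𝟙-yes : ∀ {p} {P : Set p} (d : Dec P) → P → 𝟙 d ≈ 1#
  𝟙-yes (yes _) p = refl
  𝟙-yes (no ¬p) p = ⊥-elim (¬p p)

  𝟙-no : ∀ {p} {P : Set p} (d : Dec P) → ¬ P → 𝟙 d ≈ 0#
  𝟙-no (yes p) ¬p = ⊥-elim (¬p p)
  𝟙-no (no _)  ¬p = refl

  conj-𝟙 : ∀ {p} {P : Set p} (d : Dec P) → conj (𝟙 d) ≈ 𝟙 d
  conj-𝟙 (yes _) = conj-fromℝ _
  conj-𝟙 (no _)  = conj-fromℝ _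

  opaque
    unfolding ∑

    ∑-δ : ∀ {t} (i : Bits t) (f : Bits t → ℂ) → ∑ (λ x → 𝟙 (i ≟ᵇ x) * f x) ≈ f i
    ∑-δ [] f = trans (*-congʳ (𝟙-yes ([] ≟ᵇ []) ≡.refl)) (*-identityˡ _)
    ∑-δ {suc t} (b ∷ i) f = split b
      where
      hit : ∀ b → ∑ (λ x → 𝟙 ((b ∷ i) ≟ᵇ (b ∷ x)) * f (b ∷ x)) ≈ f (b ∷ i)
      hit b = trans (∑-cong λ x → *-congʳ (𝟙-⇔ ((b ∷ i) ≟ᵇ (b ∷ x)) (i ≟ᵇ x) Vec.∷-injectiveʳ (≡.cong (b ∷_))))
                    (∑-δ i (f ∘ (b ∷_)))
      miss : ∀ b c → b ≢ c → ∑ (λ x → 𝟙 ((b ∷ i) ≟ᵇ (c ∷ x)) * f (c ∷ x)) ≈ 0#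
      miss b c b≢c = trans (∑-cong λ x → trans (*-congʳ (𝟙-no ((b ∷ i) ≟ᵇ (c ∷ x)) (b≢c ∘ Vec.∷-injectiveˡ))) (zeroˡ _))
                           (∑-0 {t})
      split : ∀ b → ∑ (λ x → 𝟙 ((b ∷ i) ≟ᵇ x) * f x) ≈ f (b ∷ i)
      split false = trans (+-cong (hit false) (miss false true λ ())) (+-identityʳ _)
      split true  = trans (+-cong (miss true false λ ()) (hit true)) (+-identityˡ _)

  setoidᴹ : ℕ → Setoid 0ℓ 0ℓ
  setoidᴹ t = record
    { Carrier = Matrix t
    ; _≈_ = _≈ᴹ_
    ; isEquivalence = record
      { refl  = entrywise λ _ _ → refl
      ; sym   = λ p → entrywise λ x y → sym (at p x y)
      ; trans = λ p q → entrywise λ x y → trans (at p x y) (at q x y)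
      }
    }

  module _ {t : ℕ} where
    open Setoid (setoidᴹ t) public
      using () renaming (refl to ≈ᴹ-refl; sym to ≈ᴹ-sym; trans to ≈ᴹ-trans)

  +ᴹ-cong : ∀ {t} {M M′ N N′ : Matrix t} → M ≈ᴹ M′ → N ≈ᴹ N′ → M +ᴹ N ≈ᴹ M′ +ᴹ N′
  +ᴹ-cong p q = entrywise λ x y → +-cong (at p x y) (at q x y)

  ∙-cong : ∀ {t} {M M′ N N′ : Matrix t} → M ≈ᴹ M′ → N ≈ᴹ N′ → M ∙ N ≈ᴹ M′ ∙ N′
  ∙-cong p q = entrywise λ x y → ∑-cong λ z → *-cong (at p x z) (at q z y)

  †-cong : ∀ {t} {M N : Matrix t} → M ≈ᴹ N → M † ≈ᴹ N †
  †-cong p = entrywise λ x y → conj-cong (at p y x)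

  tr-cong : ∀ {t} {M N : Matrix t} → M ≈ᴹ N → tr M ≈ tr N
  tr-cong p = ∑-cong λ x → at p x x

  ∙-assoc : ∀ {t} (L M N : Matrix t) → L ∙ M ∙ N ≈ᴹ L ∙ (M ∙ N)
  ∙-assoc L M N = entrywise λ x y → begin
    ∑ (λ z → ∑ (λ w → L x w * M w z) * N z y)      ≈⟨ ∑-cong (λ z → sym (∑-*ʳ _ _)) ⟩
    ∑ (λ z → ∑ (λ w → (L x w * M w z) * N z y))    ≈⟨ ∑-cong (λ z → ∑-cong λ w → *-assoc _ _ _) ⟩
    ∑ (λ z → ∑ (λ w → L x w * (M w z * N z y)))    ≈⟨ ∑-swap _ ⟩
    ∑ (λ w → ∑ (λ z → L x w * (M w z * N z y)))    ≈⟨ ∑-cong (λ w → ∑-*ˡ _ _) ⟩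
    ∑ (λ w → L x w * ∑ (λ z → M w z * N z y))      ∎

  ∙-identityˡ : ∀ {t} (M : Matrix t) → Iᴹ ∙ M ≈ᴹ M
  ∙-identityˡ M = entrywise λ x y → ∑-δ x (λ z → M z y)

  ∙-identityʳ : ∀ {t} (M : Matrix t) → M ∙ Iᴹ ≈ᴹ M
  ∙-identityʳ M = entrywise λ x y → trans
    (∑-cong λ z → trans (*-comm _ _) (*-congʳ (𝟙-⇔ (z ≟ᵇ y) (y ≟ᵇ z) ≡.sym ≡.sym)))
    (∑-δ y (M x))

  ∙-distribʳ-+ : ∀ {t} (L M N : Matrix t) → (L +ᴹ M) ∙ N ≈ᴹ L ∙ N +ᴹ M ∙ N
  ∙-distribʳ-+ L M N = entrywise λ x y → trans (∑-cong λ z → distribʳ _ _ _) (∑-+ _ _)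

  Iᴹ-hermitian : ∀ {t} → Iᴹ {t} † ≈ᴹ Iᴹ
  Iᴹ-hermitian = entrywise λ x y → trans (conj-𝟙 (y ≟ᵇ x)) (𝟙-⇔ (y ≟ᵇ x) (x ≟ᵇ y) ≡.sym ≡.sym)

  tr-+ : ∀ {t} (M N : Matrix t) → tr (M +ᴹ N) ≈ tr M + tr N
  tr-+ M N = ∑-+ _ _

  tr-comm : ∀ {t} (M N : Matrix t) → tr (M ∙ N) ≈ tr (N ∙ M)
  tr-comm M N = trans (∑-swap _) (∑-cong λ z → ∑-cong λ x → *-comm _ _)

  tr-sandwich : ∀ {t} (A M B : Matrix t) → tr (A ∙ M ∙ B) ≈ tr (B ∙ A ∙ M)
  tr-sandwich A M B = trans (tr-comm (A ∙ M) B) (tr-cong (≈ᴹ-sym (∙-assoc B A M)))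

  $ᴷ-cong : ∀ {t} {M N : Matrix t} {u v : Ket t} → M ≈ᴹ N → (∀ x → u x ≈ v x) → ∀ x → (M $ᴷ u) x ≈ (N $ᴷ v) x
  $ᴷ-cong p q x = ∑-cong λ y → *-cong (at p x y) (q y)

  $ᴷ-∙ : ∀ {t} (M N : Matrix t) v x → (M ∙ N $ᴷ v) x ≈ (M $ᴷ N $ᴷ v) x
  $ᴷ-∙ M N v x = begin
    ∑ (λ y → ∑ (λ z → M x z * N z y) * v y)     ≈⟨ ∑-cong (λ y → sym (∑-*ʳ _ _)) ⟩
    ∑ (λ y → ∑ (λ z → (M x z * N z y) * v y))   ≈⟨ ∑-swap _ ⟩
    ∑ (λ z → ∑ (λ y → (M x z * N z y) * v y))   ≈⟨ ∑-cong (λ z → ∑-cong λ y → *-assoc _ _ _) ⟩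
    ∑ (λ z → ∑ (λ y → M x z * (N z y * v y)))   ≈⟨ ∑-cong (λ z → ∑-*ˡ _ _) ⟩
    ∑ (λ z → M x z * ∑ (λ y → N z y * v y))     ∎

  ⟨∣⟩-congʳ : ∀ {t} {u v w : Ket t} → (∀ x → v x ≈ w x) → ⟨ u ∣ v ⟩ ≈ ⟨ u ∣ w ⟩
  ⟨∣⟩-congʳ p = ∑-cong λ x → *-congˡ (p x)

  ⟨∣⟩-congˡ : ∀ {t} {u v w : Ket t} → (∀ x → u x ≈ v x) → ⟨ u ∣ w ⟩ ≈ ⟨ v ∣ w ⟩
  ⟨∣⟩-congˡ p = ∑-cong λ x → *-congʳ (conj-cong (p x))

  adjoint : ∀ {t} (M : Matrix t) u v → ⟨ u ∣ M $ᴷ v ⟩ ≈ ⟨ M † $ᴷ u ∣ v ⟩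
  adjoint M u v = begin
    ∑ (λ x → conj (u x) * ∑ (λ y → M x y * v y))           ≈⟨ ∑-cong (λ x → sym (∑-*ˡ _ _)) ⟩
    ∑ (λ x → ∑ (λ y → conj (u x) * (M x y * v y)))         ≈⟨ ∑-swap _ ⟩
    ∑ (λ y → ∑ (λ x → conj (u x) * (M x y * v y)))         ≈⟨ ∑-cong (λ y → ∑-cong λ x → step x y) ⟩
    ∑ (λ y → ∑ (λ x → conj (conj (M x y) * u x) * v y))    ≈⟨ ∑-cong (λ y → ∑-*ʳ _ _) ⟩
    ∑ (λ y → ∑ (λ x → conj (conj (M x y) * u x)) * v y)    ≈⟨ ∑-cong (λ y → *-congʳ (sym (conj-∑ (λ x → conj (M x y) * u x)))) ⟩
    ∑ (λ y → conj (∑ (λ x → conj (M x y) * u x)) * v y)    ∎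
    where
    regroup : ∀ a b c → a * (b * c) ≈ (b * a) * c
    regroup = solve 3 (λ a b c → a :* (b :* c) := (b :* a) :* c) refl
    step : ∀ x y → conj (u x) * (M x y * v y) ≈ conj (conj (M x y) * u x) * v y
    step x y = trans (regroup _ _ _) (*-congʳ (sym (trans (conj-* _ _) (*-congʳ (conj-conj _)))))

  Positive-resp : ∀ {t} {M N : Matrix t} → M ≈ᴹ N → Positive M → Positive N
  Positive-resp {M = M} {N} p M≥0 v =
    ≤ᶜ-resp refl (⟨∣⟩-congʳ {u = v} ($ᴷ-cong {M = M} {N} {v} p λ _ → refl)) (M≥0 v)

  Positive-0 : ∀ {t} → Positive {t} 0ᴹ
  Positive-0 {t} v = ≤ᶜ-reflexive (sym (trans
    (∑-cong λ x → trans (*-congˡ (trans (∑-cong λ y → zeroˡ (v y)) (∑-0 {t}))) (zeroʳ _)) (∑-0 {t})))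

  Positive-+ : ∀ {t} {M N : Matrix t} → Positive M → Positive N → Positive (M +ᴹ N)
  Positive-+ {M = M} {N} M≥0 N≥0 v = ≤ᶜ-resp refl eq (0≤ᶜ+ (M≥0 v) (N≥0 v))
    where
    eq : ⟨ v ∣ M $ᴷ v ⟩ + ⟨ v ∣ N $ᴷ v ⟩ ≈ ⟨ v ∣ M +ᴹ N $ᴷ v ⟩
    eq = sym (trans (∑-cong λ x → trans (*-congˡ (trans (∑-cong λ y → distribʳ _ _ _) (∑-+ _ _))) (distribˡ _ _ _))
                    (∑-+ _ _))

  opaque
    unfolding ∑

    Positive-∑ : ∀ {s t} {M : Bits s → Matrix t} → (∀ i → Positive (M i)) → Positive (∑ᴹ M)
    Positive-∑ {zero}  p = p []
    Positive-∑ {suc s} p = Positive-+ (Positive-∑ (p ∘ (false ∷_))) (Positive-∑ (p ∘ (true ∷_)))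

  Positive-sandwich : ∀ {t} {A M B : Matrix t} → A † ≈ᴹ B → Positive M → Positive (A ∙ M ∙ B)
  Positive-sandwich {A = A} {M} {B} p M≥0 v = ≤ᶜ-resp refl (sym eq) (M≥0 w)
    where
    w = B $ᴷ v
    eq : ⟨ v ∣ A ∙ M ∙ B $ᴷ v ⟩ ≈ ⟨ w ∣ M $ᴷ w ⟩
    eq = begin
      ⟨ v ∣ A ∙ M ∙ B $ᴷ v ⟩      ≈⟨ ⟨∣⟩-congʳ {u = v} ($ᴷ-∙ (A ∙ M) B v) ⟩
      ⟨ v ∣ A ∙ M $ᴷ w ⟩          ≈⟨ ⟨∣⟩-congʳ {u = v} ($ᴷ-∙ A M w) ⟩
      ⟨ v ∣ A $ᴷ M $ᴷ w ⟩         ≈⟨ adjoint A v (M $ᴷ w) ⟩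
      ⟨ A † $ᴷ v ∣ M $ᴷ w ⟩       ≈⟨ ⟨∣⟩-congˡ {w = M $ᴷ w} ($ᴷ-cong {u = v} p λ _ → refl) ⟩
      ⟨ w ∣ M $ᴷ w ⟩              ∎

-- The quantum variables are V = Fin n; a register q̄ = q₁,…,q_t is a
-- tuple of distinct ones.
record Register (n t : ℕ) : Set where
  field
    variables : Vec (Fin n) t
    distinct  : Unique.Unique variables

module Cylinder (em : ExcludedMiddle 0ℓ) (ℝ : CompleteOrderedField) (n : ℕ) where
  open Matrices em ℝ
  open Membership using (_∈_; _∉_)
  open DecMembership (Fin._≟_ {n}) using (_∈?_)
  open Relation.Binary.Reasoning.Setoid setoid

  infixl 9 _↾_

  _↾_ : ∀ {t} → Bits n → Vec (Fin n) t → Bits t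
  x ↾ qs = map (lookup x) qs

  AgreeOutside : ∀ {t} → Vec (Fin n) t → Bits n → Bits n → Set
  AgreeOutside qs x y = ∀ q → q ∉ qs → lookup x q ≡ lookup y q

  agreeOutside? : ∀ {t} (qs : Vec (Fin n) t) x y → Dec (AgreeOutside qs x y)
  agreeOutside? qs x y = Fin.all? λ q → ¬? (q ∈? qs) →-dec (lookup x q Bool.≟ lookup y q)

  -- M ⊗ I, with M acting on the qubits qs and I on the others.
  cylinder : ∀ {t} → Vec (Fin n) t → Matrix t → Matrix n
  cylinder qs M x y = 𝟙 (agreeOutside? qs x y) * M (x ↾ qs) (y ↾ qs)

  agree-sym : ∀ {t} {qs : Vec (Fin n) t} x y → AgreeOutside qs x y → AgreeOutside qs y x
  agree-sym x y p q q∉ = ≡.sym (p q q∉)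

  agree-trans : ∀ {t} {qs : Vec (Fin n) t} x y z → AgreeOutside qs x y → AgreeOutside qs y z → AgreeOutside qs x z
  agree-trans x y z p p′ q q∉ = ≡.trans (p q q∉) (p′ q q∉)

  head∉ : ∀ {t} {q : Fin n} {qs : Vec (Fin n) t} → All (q ≢_) qs → q ∉ qs
  head∉ (q≢ ∷ _)  (here q≡)  = q≢ q≡
  head∉ (_ ∷ q≢s) (there q∈) = head∉ q≢s q∈

  lookup-ext : ∀ {m} (x y : Bits m) → (∀ q → lookup x q ≡ lookup y q) → x ≡ y
  lookup-ext []      []      p = ≡.refl
  lookup-ext (_ ∷ x) (_ ∷ y) p = ≡.cong₂ _∷_ (p zero) (lookup-ext x y (p ∘ suc))

  ↾-lookup : ∀ {t} {qs : Vec (Fin n) t} x y {q} → x ↾ qs ≡ y ↾ qs → q ∈ qs → lookup x q ≡ lookup y q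
  ↾-lookup x y p (here ≡.refl) = Vec.∷-injectiveˡ p
  ↾-lookup x y p (there q∈)    = ↾-lookup x y (Vec.∷-injectiveʳ p) q∈

  opaque
    unfolding ∑

    ∑-fibre : ∀ {t} (qs : Vec (Fin n) t) → Unique.Unique qs → ∀ x (F : Bits t → ℂ) →
              ∑ (λ z → 𝟙 (agreeOutside? qs x z) * F (z ↾ qs)) ≈ ∑ F
    ∑-fibre [] _ x F = trans
      (∑-cong λ z → *-congʳ (𝟙-⇔ (agreeOutside? [] x z) (x ≟ᵇ z)
                               (λ p → lookup-ext x z λ q → p q λ ())
                               (λ { ≡.refl q _ → ≡.refl })))
      (∑-δ x (λ _ → F []))
    ∑-fibre (q ∷ qs) (q≢ ∷ distinct) x F = begin
      ∑ (λ z → 𝟙 (agreeOutside? (q ∷ qs) x z) * F (lookup z q ∷ z ↾ qs))   ≈⟨ ∑-cong (λ z → branch z (lookup z q) ≡.refl) ⟩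
      ∑ (λ z → summand false z + summand true z)                           ≈⟨ ∑-+ (summand false) (summand true) ⟩
      ∑ (summand false) + ∑ (summand true)                                 ≈⟨ +-cong (∑-fibre qs distinct (x [ q ]≔ false) (F ∘ (false ∷_)))
                                                                                     (∑-fibre qs distinct (x [ q ]≔ true) (F ∘ (true ∷_))) ⟩
      ∑ F                                                                  ∎
      where
      summand : Bool → Bits n → ℂ
      summand b z = 𝟙 (agreeOutside? qs (x [ q ]≔ b) z) * F (b ∷ z ↾ qs)

      to : ∀ z b → lookup z q ≡ b → AgreeOutside (q ∷ qs) x z → AgreeOutside qs (x [ q ]≔ b) z
      to z b zq≡b p r r∉ with r Fin.≟ q
      ... | yes ≡.refl = ≡.trans (Vec.lookup∘updateAt q x) (≡.sym zq≡b)
      ... | no r≢q     = ≡.trans (Vec.lookup∘updateAt′ r q r≢q x)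
                                 (p r λ { (here r≡q) → r≢q r≡q ; (there r∈) → r∉ r∈ })

      from : ∀ z b → AgreeOutside qs (x [ q ]≔ b) z → AgreeOutside (q ∷ qs) x z
      from z b p r r∉ = ≡.trans (≡.sym (Vec.lookup∘updateAt′ r q (r∉ ∘ here) x)) (p r (r∉ ∘ there))

      hit : ∀ z b → lookup z q ≡ b → 𝟙 (agreeOutside? (q ∷ qs) x z) * F (b ∷ z ↾ qs) ≈ summand b z
      hit z b zq≡b = *-congʳ (𝟙-⇔ (agreeOutside? (q ∷ qs) x z) (agreeOutside? qs (x [ q ]≔ b) z)
                                  (to z b zq≡b) (from z b))

      miss : ∀ z b c → lookup z q ≡ b → c ≢ b → summand c z ≈ 0#
      miss z b c zq≡b c≢b = trans
        (*-congʳ (𝟙-no (agreeOutside? qs (x [ q ]≔ c) z)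
          λ p → c≢b (≡.trans (≡.sym (Vec.lookup∘updateAt q x)) (≡.trans (p q (head∉ q≢)) zq≡b))))
        (zeroˡ _)

      branch : ∀ z b → lookup z q ≡ b →
               𝟙 (agreeOutside? (q ∷ qs) x z) * F (b ∷ z ↾ qs) ≈ summand false z + summand true z
      branch z false eq = trans (hit z false eq) (sym (trans (+-congˡ (miss z false true eq λ ())) (+-identityʳ _)))
      branch z true  eq = trans (hit z true eq) (sym (trans (+-congʳ (miss z true false eq λ ())) (+-identityˡ _)))

  cylinder-cong : ∀ {t} (qs : Vec (Fin n) t) {M N} → M ≈ᴹ N → cylinder qs M ≈ᴹ cylinder qs N
  cylinder-cong qs p = entrywise λ x y → *-congˡ (at p _ _)

  cylinder-+ : ∀ {t} (qs : Vec (Fin n) t) M N → cylinder qs (M +ᴹ N) ≈ᴹ cylinder qs M +ᴹ cylinder qs N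
  cylinder-+ qs M N = entrywise λ x y → distribˡ _ _ _

  cylinder-∑ : ∀ {s t} (qs : Vec (Fin n) t) (M : Bits s → Matrix t) →
               cylinder qs (∑ᴹ M) ≈ᴹ ∑ᴹ (λ i → cylinder qs (M i))
  cylinder-∑ qs M = entrywise λ x y → sym (∑-*ˡ _ _)

  cylinder-† : ∀ {t} (qs : Vec (Fin n) t) M → cylinder qs (M †) ≈ᴹ cylinder qs M †
  cylinder-† qs M = entrywise λ x y → sym (trans (conj-* _ _) (*-congʳ (trans
    (conj-𝟙 (agreeOutside? qs y x))
    (𝟙-⇔ (agreeOutside? qs y x) (agreeOutside? qs x y) (agree-sym y x) (agree-sym x y)))))

  cylinder-I : ∀ {t} (qs : Vec (Fin n) t) → cylinder qs Iᴹ ≈ᴹ Iᴹ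
  cylinder-I qs = entrywise entry
    where
    everywhere : ∀ x y → AgreeOutside qs x y → x ↾ qs ≡ y ↾ qs → ∀ q → lookup x q ≡ lookup y q
    everywhere x y p r q with q ∈? qs
    ... | yes q∈ = ↾-lookup x y r q∈
    ... | no  q∉ = p q q∉
    distinct : ∀ x y → x ≢ y → Dec (AgreeOutside qs x y) →
               𝟙 (agreeOutside? qs x y) * 𝟙 (x ↾ qs ≟ᵇ y ↾ qs) ≈ 0#
    distinct x y x≢y (no ¬p) = trans (*-congʳ (𝟙-no (agreeOutside? qs x y) ¬p)) (zeroˡ _)
    distinct x y x≢y (yes p) = trans
      (*-congˡ (𝟙-no (x ↾ qs ≟ᵇ y ↾ qs) λ r → x≢y (lookup-ext x y (everywhere x y p r)))) (zeroʳ _)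
    split : ∀ x y → Dec (x ≡ y) → 𝟙 (agreeOutside? qs x y) * 𝟙 (x ↾ qs ≟ᵇ y ↾ qs) ≈ 𝟙 (x ≟ᵇ y)
    split x y (yes ≡.refl) = trans
      (*-cong (𝟙-yes (agreeOutside? qs x x) λ _ _ → ≡.refl) (𝟙-yes (x ↾ qs ≟ᵇ x ↾ qs) ≡.refl))
      (trans (*-identityˡ _) (sym (𝟙-yes (x ≟ᵇ x) ≡.refl)))
    split x y (no x≢y) = trans (distinct x y x≢y (agreeOutside? qs x y)) (sym (𝟙-no (x ≟ᵇ y) x≢y))
    entry : ∀ x y → 𝟙 (agreeOutside? qs x y) * 𝟙 (x ↾ qs ≟ᵇ y ↾ qs) ≈ 𝟙 (x ≟ᵇ y)
    entry x y = split x y (x ≟ᵇ y)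

  cylinder-∙ : ∀ {t} (qs : Vec (Fin n) t) → Unique.Unique qs → ∀ M N →
               cylinder qs (M ∙ N) ≈ᴹ cylinder qs M ∙ cylinder qs N
  cylinder-∙ qs distinct M N = entrywise λ x y → sym (begin
    ∑ (λ z → (𝟙 (agreeOutside? qs x z) * M (x ↾ qs) (z ↾ qs)) * (𝟙 (agreeOutside? qs z y) * N (z ↾ qs) (y ↾ qs)))
      ≈⟨ ∑-cong (λ z → entry x y z (M (x ↾ qs) (z ↾ qs)) (N (z ↾ qs) (y ↾ qs))) ⟩
    ∑ (λ z → 𝟙 (agreeOutside? qs x z) * (𝟙 (agreeOutside? qs x y) * (M (x ↾ qs) (z ↾ qs) * N (z ↾ qs) (y ↾ qs))))
      ≈⟨ ∑-fibre qs distinct x (λ w → 𝟙 (agreeOutside? qs x y) * (M (x ↾ qs) w * N w (y ↾ qs))) ⟩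
    ∑ (λ w → 𝟙 (agreeOutside? qs x y) * (M (x ↾ qs) w * N w (y ↾ qs)))
      ≈⟨ ∑-*ˡ _ _ ⟩
    𝟙 (agreeOutside? qs x y) * ∑ (λ w → M (x ↾ qs) w * N w (y ↾ qs)) ∎)
    where
    open RingSolver commutativeRingᶜ
    regroup : ∀ a b c d → (a * b) * (c * d) ≈ a * (c * (b * d))
    regroup = solve 4 (λ a b c d → (a :* b) :* (c :* d) := a :* (c :* (b :* d))) refl
    entry : ∀ x y z m m′ → (𝟙 (agreeOutside? qs x z) * m) * (𝟙 (agreeOutside? qs z y) * m′)
                         ≈ 𝟙 (agreeOutside? qs x z) * (𝟙 (agreeOutside? qs x y) * (m * m′))
    entry x y z m m′ = split (agreeOutside? qs x z)
      where
      split : Dec (AgreeOutside qs x z) →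
              (𝟙 (agreeOutside? qs x z) * m) * (𝟙 (agreeOutside? qs z y) * m′)
              ≈ 𝟙 (agreeOutside? qs x z) * (𝟙 (agreeOutside? qs x y) * (m * m′))
      split (no ¬p) = trans (regroup _ _ _ _) (trans (vanish _) (sym (vanish _)))
        where
        vanish : ∀ c → 𝟙 (agreeOutside? qs x z) * c ≈ 0#
        vanish c = trans (*-congʳ (𝟙-no (agreeOutside? qs x z) ¬p)) (zeroˡ c)
      split (yes p) = trans (regroup _ _ _ _) (*-congˡ (*-congʳ
        (𝟙-⇔ (agreeOutside? qs z y) (agreeOutside? qs x y) (agree-trans x z y p) (agree-trans z x y (agree-sym x z p)))))

module MatrixSeries (em : ExcludedMiddle 0ℓ) (ℝ : CompleteOrderedField) where
  open Matrices em ℝ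
  private
    module ℝ = CompleteOrderedField ℝ
    module A = RealAnalysis em ℝ
    module Sℝ = RingSolver ℝ.commutativeRing

  partialSumᴹ : ∀ {t} → (ℕ → Matrix t) → ℕ → Matrix t
  partialSumᴹ M zero    = 0ᴹ
  partialSumᴹ M (suc N) = partialSumᴹ M N +ᴹ M N

  -- L = Σ_{i ≥ 0} M i.  Operators form a finite-dimensional space, so the
  -- convergence is that of each matrix entry.
  IsSum : ∀ {t} → (ℕ → Matrix t) → Matrix t → Set
  IsSum M L = ∀ x y → (λ N → partialSumᴹ M N x y) ⟶ᶜ L x y

  abstract
    IsSum-unique : ∀ {t} {M : ℕ → Matrix t} {L L′} → IsSum M L → IsSum M L′ → L ≈ᴹ L′
    IsSum-unique p q = entrywise λ x y → ⟶ᶜ-unique (p x y) (q x y)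

  partialSumᴹ-cong : ∀ {t} {M M′ : ℕ → Matrix t} → (∀ i → M i ≈ᴹ M′ i) → ∀ N → partialSumᴹ M N ≈ᴹ partialSumᴹ M′ N
  partialSumᴹ-cong p zero    = ≈ᴹ-refl
  partialSumᴹ-cong p (suc N) = +ᴹ-cong (partialSumᴹ-cong p N) (p N)

  IsSum-cong : ∀ {t} {M M′ : ℕ → Matrix t} {L} → (∀ i → M i ≈ᴹ M′ i) → IsSum M L → IsSum M′ L
  IsSum-cong p q x y = ⟶ᶜ-cong (λ N → at (partialSumᴹ-cong p N) x y) refl (q x y)

  partialSumᴹ-positive : ∀ {t} {M : ℕ → Matrix t} → (∀ i → Positive (M i)) → ∀ N → Positive (partialSumᴹ M N)
  partialSumᴹ-positive p zero    = Positive-0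
  partialSumᴹ-positive p (suc N) = Positive-+ (partialSumᴹ-positive p N) (p N)

  abstract
    sum-positive : ∀ {t} {M : ℕ → Matrix t} {L} → (∀ i → Positive (M i)) → IsSum M L → Positive L
    sum-positive {M = M} {L} p q v = ⟶ᶜ-≥ converges (λ N → partialSumᴹ-positive p N v)
      where
      converges : (λ N → ⟨ v ∣ partialSumᴹ M N $ᴷ v ⟩) ⟶ᶜ ⟨ v ∣ L $ᴷ v ⟩
      converges = ∑-⟶ λ x → ⟶ᶜ-* (conj (v x)) (∑-⟶ λ y →
        ⟶ᶜ-cong (λ N → *-comm _ _) (*-comm _ _) (⟶ᶜ-* (v y) (q x y)))

    sum-trace-≤ : ∀ {t} {M : ℕ → Matrix t} {L b} → IsSum M L → (∀ N → tr (partialSumᴹ M N) ≤ᶜ b) → tr L ≤ᶜ b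
    sum-trace-≤ q = ⟶ᶜ-≤ (∑-⟶ λ x → q x x)

  opaque
    unfolding addᶜ

    re-+ : ∀ z w → re (z + w) ≡ re z ℝ.+ re w
    re-+ z w = ≡.refl

    im-+ : ∀ z w → im (z + w) ≡ im z ℝ.+ im w
    im-+ z w = ≡.refl

    re-expand : ∀ γ ζ a b b′ d → re ((a + (γ +i ζ) * b) + conj (γ +i ζ) * (b′ + (γ +i ζ) * d)) ℝ.≈
      re a ℝ.+ (γ ℝ.* (re b ℝ.+ re b′) ℝ.+ ζ ℝ.* (im b′ ℝ.- im b)) ℝ.+ (γ ℝ.* γ ℝ.+ ζ ℝ.* ζ) ℝ.* re d
    re-expand γ ζ a b b′ d = solve 9
      (λ γ ζ ra rb ib rb′ ib′ rd id →
        (ra :+ (γ :* rb :- ζ :* ib)) :+ (γ :* (rb′ :+ (γ :* rd :- ζ :* id)) :- (:- ζ) :* (ib′ :+ (γ :* id :+ ζ :* rd)))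
        := ra :+ (γ :* (rb :+ rb′) :+ ζ :* (ib′ :- ib)) :+ (γ :* γ :+ ζ :* ζ) :* rd)
      ℝ.refl γ ζ (re a) (re b) (im b) (re b′) (im b′) (re d) (im d)
      where open Sℝ

    im-expand : ∀ γ ζ a b b′ d → im ((a + (γ +i ζ) * b) + conj (γ +i ζ) * (b′ + (γ +i ζ) * d)) ℝ.≈
      im a ℝ.+ (γ ℝ.* (im b ℝ.+ im b′) ℝ.+ ζ ℝ.* (re b ℝ.- re b′)) ℝ.+ (γ ℝ.* γ ℝ.+ ζ ℝ.* ζ) ℝ.* im d
    im-expand γ ζ a b b′ d = solve 9
      (λ γ ζ ia rb ib rb′ ib′ rd id →
        (ia :+ (γ :* ib :+ ζ :* rb)) :+ (γ :* (ib′ :+ (γ :* id :+ ζ :* rd)) :+ (:- ζ) :* (rb′ :+ (γ :* rd :- ζ :* id)))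
        := ia :+ (γ :* (ib :+ ib′) :+ ζ :* (rb :- rb′)) :+ (γ :* γ :+ ζ :* ζ) :* id)
      ℝ.refl γ ζ (im a) (re b) (im b) (re b′) (im b′) (re d) (im d)
      where open Sℝ

  -- ⟨w∣Mw⟩ for w = ∣x⟩ + c∣y⟩
  quadratic-form : ∀ {t} {M : Matrix t} → Positive M → ∀ c x y →
                   0# ≤ᶜ (M x x + c * M x y) + conj c * (M y x + c * M y y)
  quadratic-form {t} {M} M≥0 c x y = ≤ᶜ-resp refl eq (M≥0 w)
    where
    open RingSolver commutativeRingᶜ
    open Relation.Binary.Reasoning.Setoid setoid
    w : Ket t
    w z = ket x z + c * ket y z
    Mw : ∀ a → (M $ᴷ w) a ≈ M a x + c * M a y
    Mw a = begin
      ∑ (λ z → M a z * (ket x z + c * ket y z))             ≈⟨ ∑-cong (λ z → regroup (M a z) (ket x z) c (ket y z)) ⟩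
      ∑ (λ z → ket x z * M a z + c * (ket y z * M a z))     ≈⟨ ∑-+ _ _ ⟩
      ∑ (λ z → ket x z * M a z) + ∑ (λ z → c * (ket y z * M a z))
                                                            ≈⟨ +-cong (∑-δ x (M a)) (trans (∑-*ˡ c _) (*-congˡ (∑-δ y (M a)))) ⟩
      M a x + c * M a y                                     ∎
      where
      regroup : ∀ m p c q → m * (p + c * q) ≈ p * m + c * (q * m)
      regroup = solve 4 (λ m p c q → m :* (p :+ c :* q) := p :* m :+ c :* (q :* m)) refl
    conj-w : ∀ z → conj (w z) ≈ ket x z + conj c * ket y z
    conj-w z = trans (conj-+ _ _) (+-cong (conj-𝟙 (x ≟ᵇ z)) (trans (conj-* _ _) (*-congˡ (conj-𝟙 (y ≟ᵇ z)))))
    eq : ⟨ w ∣ M $ᴷ w ⟩ ≈ (M x x + c * M x y) + conj c * (M y x + c * M y y)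
    eq = begin
      ∑ (λ z → conj (w z) * (M $ᴷ w) z)                     ≈⟨ ∑-cong (λ z → *-congʳ (conj-w z)) ⟩
      ∑ (λ z → (ket x z + conj c * ket y z) * (M $ᴷ w) z)   ≈⟨ ∑-cong (λ z → regroup (ket x z) (conj c) (ket y z) ((M $ᴷ w) z)) ⟩
      ∑ (λ z → ket x z * (M $ᴷ w) z + conj c * (ket y z * (M $ᴷ w) z))
                                                            ≈⟨ ∑-+ _ _ ⟩
      ∑ (λ z → ket x z * (M $ᴷ w) z) + ∑ (λ z → conj c * (ket y z * (M $ᴷ w) z))
                                                            ≈⟨ +-cong (∑-δ x (M $ᴷ w)) (trans (∑-*ˡ (conj c) _) (*-congˡ (∑-δ y (M $ᴷ w)))) ⟩
      (M $ᴷ w) x + conj c * (M $ᴷ w) y                      ≈⟨ +-cong (Mw x) (*-congˡ (Mw y)) ⟩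
      (M x x + c * M x y) + conj c * (M y x + c * M y y)    ∎
      where
      regroup : ∀ p c q m → (p + c * q) * m ≈ p * m + c * (q * m)
      regroup = solve 4 (λ p c q m → (p :+ c :* q) :* m := p :* m :+ c :* (q :* m)) refl

  diagonal-nonNeg : ∀ {t} {M : Matrix t} → Positive M → ∀ x → 0# ≤ᶜ M x x
  diagonal-nonNeg {M = M} M≥0 x = ≤ᶜ-resp refl
    (trans (+-cong (trans (+-congˡ (zeroˡ _)) (+-identityʳ _)) (trans (*-congʳ (conj-fromℝ _)) (zeroˡ _))) (+-identityʳ _))
    (quadratic-form M≥0 0# x x)

  trace-nonNeg : ∀ {t} {M : Matrix t} → Positive M → 0# ≤ᶜ tr M
  trace-nonNeg M≥0 = ∑-nonNeg (diagonal-nonNeg M≥0)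

  module EntryBounds {t} {M : Matrix t} (M≥0 : Positive M) (x y : Bits t) where
    open Sℝ
    T : ℝ.Carrier
    T = re (tr M)

    diag≤T : ∀ z → re (M z z) ℝ.≤ T
    diag≤T z = re≤ (∑-term-≤ {f = λ z → M z z} (diagonal-nonNeg M≥0) z)

    real-diag : ∀ z → im (M z z) ℝ.≈ ℝ.0#
    real-diag z = ℝ.sym (im≡ (diagonal-nonNeg M≥0 z))

    re-form : ∀ γ ζ → ℝ.0# ℝ.≤ re (M x x) ℝ.+ (γ ℝ.* (re (M x y) ℝ.+ re (M y x)) ℝ.+ ζ ℝ.* (im (M y x) ℝ.- im (M x y)))
                                ℝ.+ (γ ℝ.* γ ℝ.+ ζ ℝ.* ζ) ℝ.* re (M y y)
    re-form γ ζ = A.≤-respʳ-≈ (re-expand γ ζ (M x x) (M x y) (M y x) (M y y)) (re≤ (quadratic-form M≥0 (γ +i ζ) x y))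

    im-form : ∀ γ ζ → γ ℝ.* (im (M x y) ℝ.+ im (M y x)) ℝ.+ ζ ℝ.* (re (M x y) ℝ.- re (M y x)) ℝ.≈ ℝ.0#
    im-form γ ζ = ℝ.trans (ℝ.sym tidy) (ℝ.trans (ℝ.sym (im-expand γ ζ (M x x) (M x y) (M y x) (M y y)))
                                                (ℝ.sym (im≡ (quadratic-form M≥0 (γ +i ζ) x y))))
      where
      tidy : im (M x x) ℝ.+ (γ ℝ.* (im (M x y) ℝ.+ im (M y x)) ℝ.+ ζ ℝ.* (re (M x y) ℝ.- re (M y x)))
               ℝ.+ (γ ℝ.* γ ℝ.+ ζ ℝ.* ζ) ℝ.* im (M y y)
             ℝ.≈ γ ℝ.* (im (M x y) ℝ.+ im (M y x)) ℝ.+ ζ ℝ.* (re (M x y) ℝ.- re (M y x))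
      tidy = ℝ.trans (ℝ.+-cong (ℝ.+-congʳ (real-diag x)) (ℝ.trans (ℝ.*-congˡ (real-diag y)) (ℝ.zeroʳ _)))
                     (ℝ.trans (ℝ.+-identityʳ _) (ℝ.+-identityˡ _))

    re-hermitian : re (M y x) ℝ.≈ re (M x y)
    re-hermitian = ℝ.trans (from-diff (re (M x y)) (re (M y x)) (im (M x y) ℝ.+ im (M y x)))
                     (ℝ.trans (ℝ.+-congˡ (ℝ.-‿cong (im-form ℝ.0# ℝ.1#))) (minus-0 _))
      where
      from-diff : ∀ p q r → q ℝ.≈ p ℝ.- (ℝ.0# ℝ.* r ℝ.+ ℝ.1# ℝ.* (p ℝ.- q))
      from-diff = solve 3 (λ p q r → q := p :- (:0 :* r :+ :1 :* (p :- q))) ℝ.refl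
      minus-0 : ∀ p → p ℝ.- ℝ.0# ℝ.≈ p
      minus-0 = solve 1 (λ p → p :- :0 := p) ℝ.refl

    im-hermitian : im (M y x) ℝ.≈ ℝ.- im (M x y)
    im-hermitian = ℝ.trans (from-sum (im (M x y)) (im (M y x)) (re (M x y) ℝ.- re (M y x)))
                     (ℝ.trans (ℝ.+-congʳ (im-form ℝ.1# ℝ.0#)) (ℝ.+-identityˡ _))
      where
      from-sum : ∀ p q r → q ℝ.≈ (ℝ.1# ℝ.* (p ℝ.+ q) ℝ.+ ℝ.0# ℝ.* r) ℝ.+ (ℝ.- p)
      from-sum = solve 3 (λ p q r → q := (:1 :* (p :+ q) :+ :0 :* r) :+ (:- p)) ℝ.refl

    bound : ∀ s → ℝ.0# ℝ.≤ re (M x x) ℝ.+ (s ℝ.+ s) ℝ.+ re (M y y) → ℝ.- T ℝ.≤ s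
    bound s p = A.double-cancel-≤ (A.0≤⇒≤ (A.≤-respʳ-≈ (eq T (re (M x x)) (re (M y y)) s)
      (A.0≤+ (A.0≤+ (A.≤⇒0≤ (diag≤T x)) (A.≤⇒0≤ (diag≤T y))) p)))
      where
      eq : ∀ T a d s → ((T ℝ.- a) ℝ.+ (T ℝ.- d)) ℝ.+ (a ℝ.+ (s ℝ.+ s) ℝ.+ d) ℝ.≈ (s ℝ.+ s) ℝ.- (ℝ.- T ℝ.+ (ℝ.- T))
      eq = solve 4 (λ T a d s → ((T :- a) :+ (T :- d)) :+ (a :+ (s :+ s) :+ d) := (s :+ s) :- (:- T :+ (:- T))) ℝ.refl

    flip : ∀ {s} → ℝ.- T ℝ.≤ ℝ.- s → s ℝ.≤ T
    flip p = A.≤-resp (neg-neg _) (neg-neg _) (A.neg-mono-≤ p)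
      where
      neg-neg : ∀ r → ℝ.- (ℝ.- r) ℝ.≈ r
      neg-neg = solve 1 (λ r → :- (:- r) := r) ℝ.refl

    specialise : ∀ γ ζ s → γ ℝ.* (re (M x y) ℝ.+ re (M x y)) ℝ.+ ζ ℝ.* (ℝ.- im (M x y) ℝ.- im (M x y)) ℝ.≈ s ℝ.+ s →
                 γ ℝ.* γ ℝ.+ ζ ℝ.* ζ ℝ.≈ ℝ.1# → ℝ.- T ℝ.≤ s
    specialise γ ζ s p q = bound s (A.≤-respʳ-≈
      (ℝ.+-cong (ℝ.+-congˡ (ℝ.trans (ℝ.+-cong (ℝ.*-congˡ (ℝ.+-congˡ re-hermitian)) (ℝ.*-congˡ (ℝ.+-congʳ im-hermitian))) p))
                (ℝ.trans (ℝ.*-congʳ q) (ℝ.*-identityˡ _)))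
      (re-form γ ζ))

    re-lower : ℝ.- T ℝ.≤ re (M x y)
    re-lower = specialise ℝ.1# ℝ.0# _
      (solve 2 (λ r i → :1 :* (r :+ r) :+ :0 :* (:- i :- i) := r :+ r) ℝ.refl (re (M x y)) (im (M x y)))
      (solve 0 (:1 :* :1 :+ :0 :* :0 := :1) ℝ.refl)

    re-upper : re (M x y) ℝ.≤ T
    re-upper = flip (specialise (ℝ.- ℝ.1#) ℝ.0# _
      (solve 2 (λ r i → :- :1 :* (r :+ r) :+ :0 :* (:- i :- i) := :- r :+ :- r) ℝ.refl (re (M x y)) (im (M x y)))
      (solve 0 (:- :1 :* :- :1 :+ :0 :* :0 := :1) ℝ.refl))

    im-upper : im (M x y) ℝ.≤ T
    im-upper = flip (specialise ℝ.0# ℝ.1# _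
      (solve 2 (λ r i → :0 :* (r :+ r) :+ :1 :* (:- i :- i) := :- i :+ :- i) ℝ.refl (re (M x y)) (im (M x y)))
      (solve 0 (:0 :* :0 :+ :1 :* :1 := :1) ℝ.refl))

    im-lower : ℝ.- T ℝ.≤ im (M x y)
    im-lower = specialise ℝ.0# (ℝ.- ℝ.1#) _
      (solve 2 (λ r i → :0 :* (r :+ r) :+ :- :1 :* (:- i :- i) := i :+ i) ℝ.refl (re (M x y)) (im (M x y)))
      (solve 0 (:0 :* :0 :+ :- :1 :* :- :1 := :1) ℝ.refl)

  abstract
    sum-exists : ∀ {t} (M : ℕ → Matrix t) (b : ℂ) → (∀ i → Positive (M i)) →
                 (∀ N → tr (partialSumᴹ M N) ≤ᶜ b) → ∃ (IsSum M)
    sum-exists {t} M b M≥0 bounded = (λ x y → proj₁ (re-lim x y) +i proj₁ (im-lim x y)) ,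
      λ x y → A.⟶-cong (λ N → ℝ.sym (re-partialSum x y N)) ℝ.refl (proj₂ (re-lim x y)) ,
              A.⟶-cong (λ N → ℝ.sym (im-partialSum x y N)) ℝ.refl (proj₂ (im-lim x y))
      where
      T : ℕ → ℝ.Carrier
      T i = re (tr (M i))

      re-partialSum : ∀ x y N → re (partialSumᴹ M N x y) ℝ.≈ A.partialSum (λ i → re (M i x y)) N
      re-partialSum x y zero    = ℝ.refl
      re-partialSum x y (suc N) = ℝ.trans (ℝ.reflexive (re-+ _ _)) (ℝ.+-congʳ (re-partialSum x y N))

      im-partialSum : ∀ x y N → im (partialSumᴹ M N x y) ℝ.≈ A.partialSum (λ i → im (M i x y)) N
      im-partialSum x y zero    = ℝ.refl
      im-partialSum x y (suc N) = ℝ.trans (ℝ.reflexive (im-+ _ _)) (ℝ.+-congʳ (im-partialSum x y N))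

      tr-partialSum : ∀ N → re (tr (partialSumᴹ M N)) ℝ.≈ A.partialSum T N
      tr-partialSum zero    = re≈ (∑-0 {t})
      tr-partialSum (suc N) = ℝ.trans (re≈ (tr-+ (partialSumᴹ M N) (M N)))
                                (ℝ.trans (ℝ.reflexive (re-+ _ _)) (ℝ.+-congʳ (tr-partialSum N)))

      T-bounded : ∀ N → A.partialSum T N ℝ.≤ re b
      T-bounded N = A.≤-respˡ-≈ (tr-partialSum N) (re≤ (bounded N))

      re-lim : ∀ x y → ∃ λ l → A.partialSum (λ i → re (M i x y)) A.⟶ l
      re-lim x y = A.dominated-series _ T (re b) (λ i → EntryBounds.re-upper (M≥0 i) x y)
                                                 (λ i → EntryBounds.re-lower (M≥0 i) x y) T-bounded

      im-lim : ∀ x y → ∃ λ l → A.partialSum (λ i → im (M i x y)) A.⟶ l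
      im-lim x y = A.dominated-series _ T (re b) (λ i → EntryBounds.im-upper (M≥0 i) x y)
                                                 (λ i → EntryBounds.im-lower (M≥0 i) x y) T-bounded

-- T^i = T ∙ … ∙ T (i factors), with T^0 = ε.  Used for programs, for
-- their concrete and for their abstract semantics.
power : ∀ {a} {A : Set a} → A → (A → A → A) → A → ℕ → A
power ε _∙_ T zero          = ε
power ε _∙_ T (suc zero)    = T
power ε _∙_ T (suc (suc i)) = power ε _∙_ T (suc i) ∙ T

power-homo : ∀ {a b} {A : Set a} {B : Set b} {ε : A} {_∙_ : A → A → A} {ε′ : B} {_∙′_ : B → B → B} (h : A → B) →
             h ε ≡ ε′ → (∀ x y → h (x ∙ y) ≡ h x ∙′ h y) → ∀ T i → h (power ε _∙_ T i) ≡ power ε′ _∙′_ (h T) i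
power-homo h hε h∙ T zero          = hε
power-homo h hε h∙ T (suc zero)    = ≡.refl
power-homo {_∙′_ = _∙′_} h hε h∙ T (suc (suc i)) =
  ≡.trans (h∙ _ T) (≡.cong (_∙′ h T) (power-homo h hε h∙ T (suc i)))

module Quantum (em : ExcludedMiddle 0ℓ) (ℝ : CompleteOrderedField) (n : ℕ) where
  open Matrices em ℝ public
  open MatrixSeries em ℝ public
  open Cylinder em ℝ n public
  open Register public

  record Unitary (t : ℕ) : Set where
    field
      matrix     : Matrix t
      U†U≈I      : matrix † ∙ matrix ≈ᴹ Iᴹ
      UU†≈I      : matrix ∙ matrix † ≈ᴹ Iᴹ

  -- A subspace of (ℂ²)^⊗t, as its orthogonal projector.
  record Subspace (t : ℕ) : Set where
    field
      projector  : Matrix t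
      hermitian  : projector † ≈ᴹ projector
      idempotent : projector ∙ projector ≈ᴹ projector

  infix 9 _ᗮ

  _ᗮ : ∀ {t} → Subspace t → Subspace t
  _ᗮ {t} X = record
    { projector  = P⊥
    ; hermitian  = entrywise λ x y → trans (conj-+ _ _) (+-cong (at Iᴹ-hermitian x y)
                     (trans (conj-neg _) (-‿cong (at hermitian x y))))
    ; idempotent = entrywise λ x y → sym (begin
        P⊥ x y                                ≈⟨ at (∙-identityʳ P⊥) x y ⟨
        (P⊥ ∙ Iᴹ) x y                         ≈⟨ ∑-cong (λ z → *-congˡ (split z y)) ⟩
        ∑ (λ z → P⊥ x z * (P⊥ z y + P z y))   ≈⟨ trans (∑-cong λ z → distribˡ _ _ _) (∑-+ _ _) ⟩
        (P⊥ ∙ P⊥) x y + (P⊥ ∙ P) x y          ≈⟨ +-congˡ (P⊥P≈0 x y) ⟩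
        (P⊥ ∙ P⊥) x y + 0#                    ≈⟨ +-identityʳ _ ⟩
        (P⊥ ∙ P⊥) x y                         ∎)
    }
    where
    open Subspace X renaming (projector to P)
    open Relation.Binary.Reasoning.Setoid setoid
    open RingSolver commutativeRingᶜ using (solve; _:=_; _:+_; _:-_)
    P⊥ : Matrix t
    P⊥ = Iᴹ -ᴹ P
    split : ∀ x y → Iᴹ x y ≈ P⊥ x y + P x y
    split x y = solve 2 (λ i p → i := i :- p :+ p) refl (Iᴹ x y) (P x y)
    P⊥P≈0 : ∀ x y → (P⊥ ∙ P) x y ≈ 0#
    P⊥P≈0 x y = begin
      (P⊥ ∙ P) x y                          ≈⟨ solve 2 (λ a b → a := (a :+ b) :- b) refl _ ((P ∙ P) x y) ⟩
      (P⊥ ∙ P) x y + (P ∙ P) x y - (P ∙ P) x y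
                                            ≈⟨ +-cong (sym (at (∙-distribʳ-+ P⊥ P P) x y)) (-‿cong (at idempotent x y)) ⟩
      ((P⊥ +ᴹ P) ∙ P) x y - P x y           ≈⟨ +-congʳ (∑-cong λ z → *-congʳ (sym (split x z))) ⟩
      (Iᴹ ∙ P) x y - P x y                  ≈⟨ +-congʳ (at (∙-identityˡ P) x y) ⟩
      P x y - P x y                         ≈⟨ -‿inverseʳ _ ⟩
      0#                                    ∎

  open Unitary public using () renaming (matrix to unitary)
  open Subspace public using (projector)

  data BasicCommand : Set where
    skip        : BasicCommand
    _:=∣0⟩      : ∀ {t} → Register n t → BasicCommand
    _*=_        : ∀ {t} → Register n t → Unitary t → BasicCommand
    assert_[_]  : ∀ {t} → Subspace t → Register n t → BasicCommand

  infixl 5 _⨾_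

  data Program : Set where
    basic                : BasicCommand → Program
    _⨾_                  : Program → Program → Program
    if_[_]then_else_end  : ∀ {t} → Subspace t → Register n t → Program → Program → Program
    while_[_]do_end      : ∀ {t} → Subspace t → Register n t → Program → Program

  -- 𝒟(ℋ_V)
  record DensityOp : Set where
    field
      matrix   : Matrix n
      positive : Positive matrix
      trace≤1  : tr matrix ≤ᶜ 1#
  open DensityOp public

  infix 4 _≈ᴰ_

  _≈ᴰ_ : Rel DensityOp 0ℓ
  ρ ≈ᴰ σ = matrix ρ ≈ᴹ matrix σ

  infixl 9 _on_

  _on_ : ∀ {t} → Matrix t → Register n t → Matrix n
  M on q̄ = cylinder (variables q̄) M

  -- Maps 𝒟(ℋ_V) → 𝒟(ℋ_V).  That they do not increase the trace is what
  -- makes branching and iteration well defined.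
  record Transformer : Set where
    field
      apply   : DensityOp → DensityOp
      cong    : ∀ {ρ σ} → ρ ≈ᴰ σ → apply ρ ≈ᴰ apply σ
      trace-≤ : ∀ ρ → tr (matrix (apply ρ)) ≤ᶜ tr (matrix ρ)
  open Transformer public

  transformer : (f : Matrix n → Matrix n) → (∀ {M N} → M ≈ᴹ N → f M ≈ᴹ f N) →
                (∀ {M} → Positive M → Positive (f M)) →
                (∀ {M} → Positive M → tr (f M) ≤ᶜ tr M) → Transformer
  transformer f f-cong f-positive f-trace = record
    { apply   = λ ρ → record
      { matrix   = f (matrix ρ)
      ; positive = f-positive (positive ρ)
      ; trace≤1  = ≤ᶜ-trans (f-trace (positive ρ)) (trace≤1 ρ)
      }
    ; cong    = f-cong
    ; trace-≤ = λ ρ → f-trace (positive ρ)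
    }

  sandwich-cong : ∀ {t} (A B : Matrix t) {M N} → M ≈ᴹ N → A ∙ M ∙ B ≈ᴹ A ∙ N ∙ B
  sandwich-cong A B p = ∙-cong (∙-cong (≈ᴹ-refl {x = A}) p) (≈ᴹ-refl {x = B})

  tr-∙-+ : ∀ {t} (A B M : Matrix t) → tr (A ∙ M) + tr (B ∙ M) ≈ tr ((A +ᴹ B) ∙ M)
  tr-∙-+ A B M = trans (sym (tr-+ (A ∙ M) (B ∙ M))) (tr-cong (≈ᴹ-sym (∙-distribʳ-+ A B M)))

  -- tr(P⊥ρP⊥) + tr(PρP) = tr ρ
  module Measurement {t} (P : Subspace t) (q̄ : Register n t) where
    on-hermitian : (P : Subspace t) → (projector P on q̄) † ≈ᴹ projector P on q̄
    on-hermitian P = ≈ᴹ-trans (≈ᴹ-sym (cylinder-† (variables q̄) (projector P)))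
                              (cylinder-cong (variables q̄) (Subspace.hermitian P))

    on-trace : (P : Subspace t) (M : Matrix n) → tr (projector P on q̄ ∙ M ∙ projector P on q̄) ≈ tr (projector P on q̄ ∙ M)
    on-trace P M = trans (tr-sandwich (projector P on q̄) M (projector P on q̄))
      (tr-cong (∙-cong (≈ᴹ-trans (≈ᴹ-sym (cylinder-∙ (variables q̄) (distinct q̄) (projector P) (projector P)))
                                 (cylinder-cong (variables q̄) (Subspace.idempotent P))) (≈ᴹ-refl {x = M})))

    complete : projector P on q̄ +ᴹ projector (P ᗮ) on q̄ ≈ᴹ Iᴹ
    complete = ≈ᴹ-trans (≈ᴹ-sym (cylinder-+ (variables q̄) (projector P) (projector (P ᗮ))))
      (≈ᴹ-trans (cylinder-cong (variables q̄) {N = Iᴹ} (entrywise λ x y → cancel (projector P x y) (Iᴹ x y)))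
                (cylinder-I (variables q̄)))
      where
      open RingSolver commutativeRingᶜ using (solve; _:=_; _:+_; _:-_)
      cancel : ∀ p i → p + (i - p) ≈ i
      cancel = solve 2 (λ p i → p :+ (i :- p) := i) refl

    abstract
      trace-split : ∀ (M : Matrix n) → tr (projector P on q̄ ∙ M ∙ projector P on q̄)
                      + tr (projector (P ᗮ) on q̄ ∙ M ∙ projector (P ᗮ) on q̄) ≈ tr M
      trace-split M = trans (+-cong (on-trace P M) (on-trace (P ᗮ) M))
        (trans (tr-∙-+ (projector P on q̄) (projector (P ᗮ) on q̄) M)
               (tr-cong (≈ᴹ-trans (∙-cong complete (≈ᴹ-refl {x = M})) (∙-identityˡ M))))

      positive-sandwich : (P : Subspace t) {M : Matrix n} → Positive M → Positive (projector P on q̄ ∙ M ∙ projector P on q̄)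
      positive-sandwich P = Positive-sandwich (on-hermitian P)

      trace-≤-sandwich : ∀ {M : Matrix n} → Positive M → tr (projector P on q̄ ∙ M ∙ projector P on q̄) ≤ᶜ tr M
      trace-≤-sandwich {M} M≥0 = ≤ᶜ-resp refl (trace-split M) (≤ᶜ-+ʳ (trace-nonNeg (positive-sandwich (P ᗮ) M≥0)))

  -- Σᵢ |i⟩⟨0|0⟩⟨i| = I
  module Initialisation {t} (q̄ : Register n t) where
    ∣0⟩ : Ket t
    ∣0⟩ = ket (replicate t false)

    reset : Matrix n → Matrix n
    reset M = ∑ᴹ λ i → ∣ ∣0⟩ ⟩⟨ ket i ∣ on q̄ ∙ M ∙ ∣ ket i ⟩⟨ ∣0⟩ ∣ on q̄

    ketbra-† : ∀ (u v : Ket t) → ∣ u ⟩⟨ v ∣ † ≈ᴹ ∣ v ⟩⟨ u ∣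
    ketbra-† u v = entrywise λ x y → trans (conj-* _ _) (trans (*-congˡ (conj-conj _)) (*-comm _ _))

    on-† : ∀ (u v : Ket t) → (∣ u ⟩⟨ v ∣ on q̄) † ≈ᴹ ∣ v ⟩⟨ u ∣ on q̄
    on-† u v = ≈ᴹ-trans (≈ᴹ-sym (cylinder-† (variables q̄) ∣ u ⟩⟨ v ∣)) (cylinder-cong (variables q̄) (ketbra-† u v))

    abstract
      reset-positive : ∀ {M} → Positive M → Positive (reset M)
      reset-positive M≥0 = Positive-∑ λ i → Positive-sandwich (on-† ∣0⟩ (ket i)) M≥0

    collapse : ∀ i → ∣ ket i ⟩⟨ ∣0⟩ ∣ ∙ ∣ ∣0⟩ ⟩⟨ ket i ∣ ≈ᴹ ∣ ket i ⟩⟨ ket i ∣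
    collapse i = entrywise λ x y → begin
      ∑ (λ z → (ket i x * conj (∣0⟩ z)) * (∣0⟩ z * conj (ket i y)))   ≈⟨ ∑-cong (λ z → regroup (ket i x) (conj (∣0⟩ z)) (∣0⟩ z) (conj (ket i y))) ⟩
      ∑ (λ z → (∣0⟩ z * conj (∣0⟩ z)) * (ket i x * conj (ket i y)))   ≈⟨ ∑-*ʳ _ _ ⟩
      ∑ (λ z → ∣0⟩ z * conj (∣0⟩ z)) * (ket i x * conj (ket i y))     ≈⟨ *-congʳ (∑-δ (replicate t false) (λ z → conj (∣0⟩ z))) ⟩
      conj (∣0⟩ (replicate t false)) * (ket i x * conj (ket i y))     ≈⟨ *-congʳ (trans (conj-𝟙 (replicate t false ≟ᵇ replicate t false)) (𝟙-yes (replicate t false ≟ᵇ replicate t false) ≡.refl)) ⟩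
      1# * (ket i x * conj (ket i y))                                 ≈⟨ *-identityˡ _ ⟩
      ket i x * conj (ket i y)                                        ∎
      where
      open Relation.Binary.Reasoning.Setoid setoid
      open RingSolver commutativeRingᶜ using (solve; _:=_; _:*_)
      regroup : ∀ a b c d → (a * b) * (c * d) ≈ (c * b) * (a * d)
      regroup = solve 4 (λ a b c d → (a :* b) :* (c :* d) := (c :* b) :* (a :* d)) refl

    resolution : ∑ᴹ {t} (λ i → ∣ ket i ⟩⟨ ket i ∣) ≈ᴹ Iᴹ
    resolution = entrywise λ x y → trans
      (∑-cong λ i → *-cong (𝟙-⇔ (i ≟ᵇ x) (x ≟ᵇ i) ≡.sym ≡.sym) (conj-𝟙 (i ≟ᵇ y)))
      (∑-δ x (λ i → 𝟙 (i ≟ᵇ y)))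

    abstract
      reset-trace : ∀ M → tr (reset M) ≈ tr M
      reset-trace M = begin
        tr (reset M)                                                         ≈⟨ ∑-swap _ ⟩
        ∑ (λ i → tr (∣ ∣0⟩ ⟩⟨ ket i ∣ on q̄ ∙ M ∙ ∣ ket i ⟩⟨ ∣0⟩ ∣ on q̄))      ≈⟨ ∑-cong (λ i → tr-sandwich (∣ ∣0⟩ ⟩⟨ ket i ∣ on q̄) M (∣ ket i ⟩⟨ ∣0⟩ ∣ on q̄)) ⟩
        ∑ (λ i → tr (∣ ket i ⟩⟨ ∣0⟩ ∣ on q̄ ∙ ∣ ∣0⟩ ⟩⟨ ket i ∣ on q̄ ∙ M))      ≈⟨ ∑-cong (λ i → tr-cong (∙-cong (diagonal i) (≈ᴹ-refl {x = M}))) ⟩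
        ∑ (λ i → tr (∣ ket i ⟩⟨ ket i ∣ on q̄ ∙ M))                           ≈⟨ ∑-swap _ ⟩
        ∑ (λ x → ∑ (λ i → ∑ (λ z → (∣ ket i ⟩⟨ ket i ∣ on q̄) x z * M z x)))   ≈⟨ ∑-cong (λ x → trans (∑-swap _) (∑-cong λ z → ∑-*ʳ _ _)) ⟩
        tr (∑ᴹ (λ i → ∣ ket i ⟩⟨ ket i ∣ on q̄) ∙ M)                          ≈⟨ tr-cong (∙-cong total-projector (≈ᴹ-refl {x = M})) ⟩
        tr (Iᴹ ∙ M)                                                          ≈⟨ tr-cong (∙-identityˡ M) ⟩
        tr M                                                                 ∎
        where
        open Relation.Binary.Reasoning.Setoid setoid
        diagonal : ∀ i → ∣ ket i ⟩⟨ ∣0⟩ ∣ on q̄ ∙ ∣ ∣0⟩ ⟩⟨ ket i ∣ on q̄ ≈ᴹ ∣ ket i ⟩⟨ ket i ∣ on q̄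
        diagonal i = ≈ᴹ-trans (≈ᴹ-sym (cylinder-∙ (variables q̄) (distinct q̄) ∣ ket i ⟩⟨ ∣0⟩ ∣ ∣ ∣0⟩ ⟩⟨ ket i ∣))
                              (cylinder-cong (variables q̄) (collapse i))
        total-projector : ∑ᴹ (λ i → ∣ ket i ⟩⟨ ket i ∣ on q̄) ≈ᴹ Iᴹ
        total-projector = ≈ᴹ-trans (≈ᴹ-sym (cylinder-∑ (variables q̄) (λ i → ∣ ket i ⟩⟨ ket i ∣)))
          (≈ᴹ-trans (cylinder-cong (variables q̄) resolution) (cylinder-I (variables q̄)))

  module Evolution {t} (U : Unitary t) (q̄ : Register n t) where
    evolve : Matrix n → Matrix n
    evolve M = unitary U on q̄ ∙ M ∙ (unitary U on q̄) †

    abstract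
      evolve-trace : ∀ M → tr (evolve M) ≈ tr M
      evolve-trace M = trans (tr-sandwich (unitary U on q̄) M ((unitary U on q̄) †))
        (tr-cong (≈ᴹ-trans (∙-cong isometry (≈ᴹ-refl {x = M})) (∙-identityˡ M)))
        where
        isometry : (unitary U on q̄) † ∙ unitary U on q̄ ≈ᴹ Iᴹ
        isometry = ≈ᴹ-trans (∙-cong (≈ᴹ-sym (cylinder-† (variables q̄) (unitary U))) (≈ᴹ-refl {x = unitary U on q̄}))
          (≈ᴹ-trans (≈ᴹ-sym (cylinder-∙ (variables q̄) (distinct q̄) (unitary U †) (unitary U)))
            (≈ᴹ-trans (cylinder-cong (variables q̄) (Unitary.U†U≈I U)) (cylinder-I (variables q̄))))

  ⟦_⟧ᵇ : BasicCommand → Transformer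
  ⟦ skip ⟧ᵇ = record { apply = id ; cong = id ; trace-≤ = λ _ → ≤ᶜ-refl }
  ⟦ q̄ :=∣0⟩ ⟧ᵇ = transformer
    (λ ρ → ∑ᴹ λ i → ∣ ∣0⟩ ⟩⟨ ket i ∣ on q̄ ∙ ρ ∙ ∣ ket i ⟩⟨ ∣0⟩ ∣ on q̄)
    (λ p → entrywise λ x y → ∑-cong λ i → at (sandwich-cong (∣ ∣0⟩ ⟩⟨ ket i ∣ on q̄) (∣ ket i ⟩⟨ ∣0⟩ ∣ on q̄) p) x y)
    reset-positive (λ {M} _ → ≤ᶜ-reflexive (reset-trace M))
    where open Initialisation q̄
  ⟦ q̄ *= U ⟧ᵇ = transformer
    (λ ρ → unitary U on q̄ ∙ ρ ∙ (unitary U on q̄) †)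
    (sandwich-cong (unitary U on q̄) ((unitary U on q̄) †))
    (Positive-sandwich ≈ᴹ-refl) (λ {M} _ → ≤ᶜ-reflexive (Evolution.evolve-trace U q̄ M))
  ⟦ assert P [ q̄ ] ⟧ᵇ = transformer
    (λ ρ → projector P on q̄ ∙ ρ ∙ projector P on q̄)
    (sandwich-cong (projector P on q̄) (projector P on q̄))
    (Measurement.positive-sandwich P q̄ P) (Measurement.trace-≤-sandwich P q̄)

  infixl 5 _⨾ᵀ_

  _⨾ᵀ_ : Transformer → Transformer → Transformer
  F ⨾ᵀ G = record
    { apply   = λ ρ → apply G (apply F ρ)
    ; cong    = λ p → cong G (cong F p)
    ; trace-≤ = λ ρ → ≤ᶜ-trans (trace-≤ G (apply F ρ)) (trace-≤ F ρ)
    }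

  Complementary : Transformer → Transformer → Set
  Complementary F G = ∀ ρ → tr (matrix (apply F ρ)) + tr (matrix (apply G ρ)) ≤ᶜ tr (matrix ρ)

  abstract
    assert-complementary : ∀ {t} (P : Subspace t) (q̄ : Register n t) (F G : Transformer) →
                           Complementary (⟦ assert P [ q̄ ] ⟧ᵇ ⨾ᵀ F) (⟦ assert P ᗮ [ q̄ ] ⟧ᵇ ⨾ᵀ G)
    assert-complementary P q̄ F G ρ = ≤ᶜ-resp refl (Measurement.trace-split P q̄ (matrix ρ))
      (+ᶜ-mono-≤ (trace-≤ F (apply ⟦ assert P [ q̄ ] ⟧ᵇ ρ)) (trace-≤ G (apply ⟦ assert P ᗮ [ q̄ ] ⟧ᵇ ρ)))

  sumᵀ : (F G : Transformer) → Complementary F G → Transformer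
  sumᵀ F G F+G≤1 = record
    { apply = λ ρ → record
      { matrix   = matrix (apply F ρ) +ᴹ matrix (apply G ρ)
      ; positive = Positive-+ (positive (apply F ρ)) (positive (apply G ρ))
      ; trace≤1  = ≤ᶜ-trans (trace ρ) (trace≤1 ρ)
      }
    ; cong    = λ p → +ᴹ-cong (cong F p) (cong G p)
    ; trace-≤ = trace
    }
    where
    trace : ∀ ρ → tr (matrix (apply F ρ) +ᴹ matrix (apply G ρ)) ≤ᶜ tr (matrix ρ)
    trace ρ = ≤ᶜ-resp (sym (tr-+ (matrix (apply F ρ)) (matrix (apply G ρ)))) refl (F+G≤1 ρ)

  -- ρ ↦ Σ_{i ≥ 0} (B^i ⨾ E)(ρ)
  module Iteration (B E : Transformer) (B+E≤1 : Complementary B E) where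
    B^ : ℕ → Transformer
    B^ = power ⟦ skip ⟧ᵇ _⨾ᵀ_ B

    term : DensityOp → ℕ → Matrix n
    term ρ i = matrix (apply (B^ i ⨾ᵀ E) ρ)

    B^-suc : ∀ i ρ → apply (B^ (suc i)) ρ ≡ apply B (apply (B^ i) ρ)
    B^-suc zero    ρ = ≡.refl
    B^-suc (suc i) ρ = ≡.refl

    abstract
      invariant : ∀ ρ N → tr (partialSumᴹ (term ρ) N) + tr (matrix (apply (B^ N) ρ)) ≤ᶜ tr (matrix ρ)
      invariant ρ zero    = ≤ᶜ-reflexive (trans (+-congʳ (∑-0 {n})) (+-identityˡ _))
      invariant ρ (suc N) = ≤ᶜ-trans
        (≤ᶜ-resp (sym regroup) refl (+ᶜ-mono-≤ (≤ᶜ-refl {tr (partialSumᴹ (term ρ) N)}) (B+E≤1 (apply (B^ N) ρ))))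
        (invariant ρ N)
        where
        open RingSolver commutativeRingᶜ using (solve; _:=_; _:+_)
        assoc-comm : ∀ s e b → (s + e) + b ≈ s + (b + e)
        assoc-comm = solve 3 (λ s e b → (s :+ e) :+ b := s :+ (b :+ e)) refl
        regroup : tr (partialSumᴹ (term ρ) (suc N)) + tr (matrix (apply (B^ (suc N)) ρ)) ≈
                  tr (partialSumᴹ (term ρ) N) + (tr (matrix (apply B (apply (B^ N) ρ))) + tr (matrix (apply E (apply (B^ N) ρ))))
        regroup = trans
          (+-cong (tr-+ (partialSumᴹ (term ρ) N) (term ρ N)) (reflexive (≡.cong (λ σ → tr (matrix σ)) (B^-suc N ρ))))
          (assoc-comm _ _ _)

      bounded : ∀ ρ N → tr (partialSumᴹ (term ρ) N) ≤ᶜ tr (matrix ρ)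
      bounded ρ N = ≤ᶜ-trans (≤ᶜ-+ʳ (trace-nonNeg (positive (apply (B^ N) ρ)))) (invariant ρ N)

      converges : ∀ ρ → ∃ (IsSum (term ρ))
      converges ρ = sum-exists (term ρ) (tr (matrix ρ)) (λ i → positive (apply (B^ i ⨾ᵀ E) ρ)) (bounded ρ)

    series : Transformer
    series = record
      { apply = λ ρ → record
        { matrix   = proj₁ (converges ρ)
        ; positive = sum-positive (λ i → positive (apply (B^ i ⨾ᵀ E) ρ)) (proj₂ (converges ρ))
        ; trace≤1  = ≤ᶜ-trans (trace ρ) (trace≤1 ρ)
        }
      ; cong    = λ {ρ} {σ} p → IsSum-unique
                    (IsSum-cong (λ i → cong (B^ i ⨾ᵀ E) p) (proj₂ (converges ρ))) (proj₂ (converges σ))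
      ; trace-≤ = trace
      }
      where
      trace : ∀ ρ → tr (proj₁ (converges ρ)) ≤ᶜ tr (matrix ρ)
      trace ρ = sum-trace-≤ (proj₂ (converges ρ)) (bounded ρ)

    series-isSum : ∀ ρ → IsSum (term ρ) (matrix (apply series ρ))
    series-isSum ρ = proj₂ (converges ρ)

  -- In the loop the semantic functions are iterated, which is structurally
  -- recursive; ⟦while⟧-isSum below is the equation in terms of the
  -- iterated programs.
  ⟦_⟧ : Program → Transformer
  ⟦ basic e ⟧ = ⟦ e ⟧ᵇ
  ⟦ S₀ ⨾ S₁ ⟧ = ⟦ S₀ ⟧ ⨾ᵀ ⟦ S₁ ⟧
  ⟦ if P [ q̄ ]then S₁ else S₀ end ⟧ =
    sumᵀ (⟦ assert P [ q̄ ] ⟧ᵇ ⨾ᵀ ⟦ S₁ ⟧) (⟦ assert P ᗮ [ q̄ ] ⟧ᵇ ⨾ᵀ ⟦ S₀ ⟧)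
         (assert-complementary P q̄ ⟦ S₁ ⟧ ⟦ S₀ ⟧)
  ⟦ while P [ q̄ ]do S end ⟧ =
    Iteration.series (⟦ assert P [ q̄ ] ⟧ᵇ ⨾ᵀ ⟦ S ⟧) ⟦ assert P ᗮ [ q̄ ] ⟧ᵇ
                     (assert-complementary P q̄ ⟦ S ⟧ ⟦ skip ⟧ᵇ)

  _^_ : Program → ℕ → Program
  T ^ i = power (basic skip) _⨾_ T i

  ⟦while⟧-isSum : ∀ {t} (P : Subspace t) (q̄ : Register n t) S ρ →
    IsSum (λ i → matrix (apply ⟦ (basic assert P [ q̄ ] ⨾ S) ^ i ⨾ basic assert P ᗮ [ q̄ ] ⟧ ρ))
          (matrix (apply ⟦ while P [ q̄ ]do S end ⟧ ρ))
  ⟦while⟧-isSum P q̄ S ρ = IsSum-cong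
    (λ i → ≡.subst (λ F → term ρ i ≈ᴹ matrix (apply (F ⨾ᵀ ⟦ assert P ᗮ [ q̄ ] ⟧ᵇ) ρ))
                   (≡.sym (power-homo ⟦_⟧ ≡.refl (λ _ _ → ≡.refl) (basic assert P [ q̄ ] ⨾ S) i)) ≈ᴹ-refl)
    (series-isSum ρ)
    where
    open Iteration (⟦ assert P [ q̄ ] ⟧ᵇ ⨾ᵀ ⟦ S ⟧) ⟦ assert P ᗮ [ q̄ ] ⟧ᵇ (assert-complementary P q̄ ⟦ S ⟧ ⟦ skip ⟧ᵇ)

record CompleteLattice a ℓ₁ ℓ₂ : Set (lsuc (0ℓ ⊔ a ⊔ ℓ₁ ⊔ ℓ₂)) where
  field
    boundedLattice : BoundedLattice a ℓ₁ ℓ₂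

  open BoundedLattice boundedLattice public

  field
    ⋁ ⋀        : {I : Set} → (I → Carrier) → Carrier
    ⋁-upper    : ∀ {I : Set} (f : I → Carrier) i → f i ≤ ⋁ f
    ⋁-least    : ∀ {I : Set} (f : I → Carrier) b → (∀ i → f i ≤ b) → ⋁ f ≤ b
    ⋀-lower    : ∀ {I : Set} (f : I → Carrier) i → ⋀ f ≤ f i
    ⋀-greatest : ∀ {I : Set} (f : I → Carrier) b → (∀ i → b ≤ f i) → b ≤ ⋀ f

module _ {c ℓ₁ ℓ₂ a ℓ₃ ℓ₄} (C : Poset c ℓ₁ ℓ₂) (A : Poset a ℓ₃ ℓ₄) where
  private
    module C = Poset C
    module A = Poset A

  record IsGaloisConnection (α : C.Carrier → A.Carrier) (γ : A.Carrier → C.Carrier) :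
                            Set (c ⊔ ℓ₂ ⊔ a ⊔ ℓ₄) where
    field
      α-mono : α Preserves C._≤_ ⟶ A._≤_
      γ-mono : γ Preserves A._≤_ ⟶ C._≤_
      galois : ∀ x y → (x C.≤ γ y) ⇔ (α x A.≤ y)

  record IsGaloisEmbedding (α : C.Carrier → A.Carrier) (γ : A.Carrier → C.Carrier) :
                           Set (c ⊔ ℓ₂ ⊔ a ⊔ ℓ₃ ⊔ ℓ₄) where
    field
      isGaloisConnection : IsGaloisConnection α γ
      α∘γ≈id             : ∀ y → α (γ y) A.≈ y

    open IsGaloisConnection isGaloisConnection public

module AbstractInterpretation (em : ExcludedMiddle 0ℓ) (ℝ : CompleteOrderedField) (n : ℕ) where
  open Quantum em ℝ n public
  private module ℝ = CompleteOrderedField ℝ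

  -- Elements of 2^𝒟(ℋ_V).
  record StateSet : Set₁ where
    field
      member   : Pred DensityOp 0ℓ
      respects : ∀ {ρ σ} → ρ ≈ᴰ σ → member ρ → member σ
  open StateSet public

  infix 4 _∈_ _⊆_

  _∈_ : DensityOp → StateSet → Set
  ρ ∈ R = member R ρ

  _⊆_ : Rel StateSet 0ℓ
  R ⊆ R′ = ∀ ρ → ρ ∈ R → ρ ∈ R′

  𝒬 : Poset (lsuc 0ℓ) 0ℓ 0ℓ
  𝒬 = record
    { Carrier = StateSet
    ; _≈_ = λ R R′ → (R ⊆ R′) × (R′ ⊆ R)
    ; _≤_ = _⊆_
    ; isPartialOrder = record
      { isPreorder = record
        { isEquivalence = record
          { refl  = (λ _ → id) , (λ _ → id)
          ; sym   = λ (p , q) → q , p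
          ; trans = λ (p , q) (p′ , q′) → (λ ρ → p′ ρ ∘ p ρ) , (λ ρ → q ρ ∘ q′ ρ)
          }
        ; reflexive = proj₁
        ; trans     = λ p q ρ → q ρ ∘ p ρ
        }
      ; antisym = _,_
      }
    }

  ｛_｝ : DensityOp → StateSet
  ｛ ρ ｝ = record
    { member   = _≈ᴰ ρ
    ; respects = λ p q → ≈ᴹ-trans (≈ᴹ-sym p) q
    }

  -- ⟦S⟧(R) = {⟦S⟧(ρ) : ρ ∈ R}
  image : Transformer → StateSet → StateSet
  image F R = record
    { member   = λ σ → ∃ λ ρ → ρ ∈ R × σ ≈ᴰ apply F ρ
    ; respects = λ p (ρ , ρ∈R , q) → ρ , ρ∈R , ≈ᴹ-trans (≈ᴹ-sym p) q
    }

  finiteSumᴹ : ∀ {k} → (Fin k → Matrix n) → Matrix n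
  finiteSumᴹ M x y = sum λ i → M i x y
    where open Algebra.Properties.CommutativeMonoid.Sum +-commutativeMonoid using (sum)

  infixr 7 _·_

  _·_ : ℝ.Carrier → DensityOp → Matrix n
  x · ρ = fromℝ x ·ᴹ matrix ρ

  -- The families in α-∑ and α-∑∞ are finite, respectively indexed by ℕ.
  -- A summable family with any other index set has, by positivity, only
  -- countably many nonzero members, and its sum does not depend on their
  -- order, so it reduces to these.
  record WellStructuredDomain a ℓ₁ ℓ₂ : Set (lsuc (lsuc 0ℓ ⊔ a ⊔ ℓ₁ ⊔ ℓ₂)) where
    field
      completeLattice : CompleteLattice a ℓ₁ ℓ₂

    open CompleteLattice completeLattice public
      using (Carrier; poset; _∨_; ⋁; ⋁-upper; ⋁-least)
      renaming (_≈_ to _≈ᴬ_; _≤_ to _≤ᴬ_)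

    field
      α                 : StateSet → Carrier
      γ                 : Carrier → StateSet
      isGaloisEmbedding : IsGaloisEmbedding 𝒬 poset α γ

      α-∑  : ∀ {k} (ρ : Fin k → DensityOp) (x : Fin k → ℝ.Carrier) → (∀ i → ℝ.0# ℝ.< x i) →
             ∀ σ → matrix σ ≈ᴹ finiteSumᴹ (λ i → x i · ρ i) → α ｛ σ ｝ ≈ᴬ ⋁ (λ i → α ｛ ρ i ｝)
      α-∑∞ : ∀ (ρ : ℕ → DensityOp) (x : ℕ → ℝ.Carrier) → (∀ i → ℝ.0# ℝ.< x i) →
             ∀ σ → IsSum (λ i → x i · ρ i) (matrix σ) → α ｛ σ ｝ ≈ᴬ ⋁ (λ i → α ｛ ρ i ｝)

    open IsGaloisEmbedding isGaloisEmbedding public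

  module _ {a ℓ₁ ℓ₂} (𝒜 : WellStructuredDomain a ℓ₁ ℓ₂) where
    open WellStructuredDomain 𝒜

    Monotone : (Carrier → Carrier) → Set (a ⊔ ℓ₂)
    Monotone f = f Preserves _≤ᴬ_ ⟶ _≤ᴬ_

    IsSoundAbstraction : (StateSet → StateSet) → (Carrier → Carrier) → Set (lsuc 0ℓ ⊔ ℓ₂)
    IsSoundAbstraction f f♯ = ∀ R → α (f R) ≤ᴬ f♯ (α R)

    IsCompleteAbstraction : (StateSet → StateSet) → (Carrier → Carrier) → Set (lsuc 0ℓ ⊔ ℓ₁)
    IsCompleteAbstraction f f♯ = ∀ R → α (f R) ≈ᴬ f♯ (α R)

    infixl 5 _⨾♯_

    _⨾♯_ : (Carrier → Carrier) → (Carrier → Carrier) → (Carrier → Carrier)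
    f ⨾♯ g = g ∘ f

    module AbstractSemantics (⟦_⟧ᵇ♯ : BasicCommand → Carrier → Carrier) where

      -- As for ⟦_⟧, the loop iterates semantic functions; see ⟦while⟧♯.
      ⟦_⟧♯ : Program → Carrier → Carrier
      ⟦ basic e ⟧♯ = ⟦ e ⟧ᵇ♯
      ⟦ S₀ ⨾ S₁ ⟧♯ = ⟦ S₀ ⟧♯ ⨾♯ ⟦ S₁ ⟧♯
      ⟦ if P [ q̄ ]then S₁ else S₀ end ⟧♯ = λ x →
        (⟦ assert P [ q̄ ] ⟧ᵇ♯ ⨾♯ ⟦ S₁ ⟧♯) x ∨ (⟦ assert P ᗮ [ q̄ ] ⟧ᵇ♯ ⨾♯ ⟦ S₀ ⟧♯) x
      ⟦ while P [ q̄ ]do S end ⟧♯ = λ x →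
        ⋁ λ i → (power ⟦ skip ⟧ᵇ♯ _⨾♯_ (⟦ assert P [ q̄ ] ⟧ᵇ♯ ⨾♯ ⟦ S ⟧♯) i ⨾♯ ⟦ assert P ᗮ [ q̄ ] ⟧ᵇ♯) x

      ⟦^⟧♯ : ∀ T i → ⟦ T ^ i ⟧♯ ≡ power ⟦ skip ⟧ᵇ♯ _⨾♯_ ⟦ T ⟧♯ i
      ⟦^⟧♯ = power-homo ⟦_⟧♯ ≡.refl (λ _ _ → ≡.refl)

      ⟦while⟧♯ : ∀ {t} (P : Subspace t) (q̄ : Register n t) S x →
                 ⟦ while P [ q̄ ]do S end ⟧♯ x ≈ᴬ
                 ⋁ (λ i → ⟦ (basic assert P [ q̄ ] ⨾ S) ^ i ⨾ basic assert P ᗮ [ q̄ ] ⟧♯ x)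
      ⟦while⟧♯ P q̄ S x = Poset.antisym poset
        (⋁-least _ _ λ i → Poset.trans poset (Poset.reflexive poset (eq i)) (⋁-upper _ i))
        (⋁-least _ _ λ i → Poset.trans poset (Poset.reflexive poset (Poset.Eq.sym poset (eq i))) (⋁-upper _ i))
        where
        T = basic assert P [ q̄ ] ⨾ S
        eq : ∀ i → (power ⟦ skip ⟧ᵇ♯ _⨾♯_ ⟦ T ⟧♯ i ⨾♯ ⟦ assert P ᗮ [ q̄ ] ⟧ᵇ♯) x ≈ᴬ ⟦ T ^ i ⨾ basic assert P ᗮ [ q̄ ] ⟧♯ x
        eq i = Poset.Eq.reflexive poset (≡.cong (λ f → ⟦ assert P ᗮ [ q̄ ] ⟧ᵇ♯ (f x)) (≡.sym (⟦^⟧♯ T i)))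

{-# OPTIONS --safe #-}

-- A left adjoint preserves joins, so α(⟦S⟧(R)) is the least upper bound of
-- the α(⟦S⟧(ρ)), ρ ∈ R.  Condition (b) of a well-structured domain, with all
-- weights 1, turns the sums in the semantics of branching and iteration into
-- joins, and a join of sound abstractions is sound.  Completeness is soundness
-- together with the reverse inequality, and both are inherited separately.

module Submission where

open import Defs
open import Level using (Level; 0ℓ; _⊔_) renaming (suc to lsuc)
open import Data.Fin.Base using (Fin; zero; suc)
open import Data.Nat.Base using (ℕ; zero; suc)
open import Data.Product.Base using (_×_; _,_)
open import Function.Bundles using (module Equivalence)
open import Axiom.ExcludedMiddle using (ExcludedMiddle)
open import Relation.Binary.Bundles using (Poset)

module _ {a ℓ₁ ℓ₂ : Level} (em : ExcludedMiddle 0ℓ) (ℝ : CompleteOrderedField) (n : ℕ) where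
  open AbstractInterpretation em ℝ n
  private module ℝ = CompleteOrderedField ℝ
  open RealAnalysis em ℝ using (0<1)

  1·-identity : ∀ ρ → matrix ρ ≈ᴹ ℝ.1# · ρ
  1·-identity ρ = entrywise λ x y → sym (*-identityˡ (matrix ρ x y))

  module _ (𝒜 : WellStructuredDomain a ℓ₁ ℓ₂) where
    open WellStructuredDomain 𝒜
    open CompleteLattice completeLattice using (x≤x∨y; y≤x∨y; ∨-least)
    open Poset poset using (antisym) renaming (trans to ≤ᴬ-trans; reflexive to ≤ᴬ-reflexive)
    private module ≈ᴬ = Poset.Eq poset

    -- The hypothesis places every element of `R` in `γ y`; the adjunction turns `R ⊆ γ y` into the
    -- claim.
    α-lub : ∀ R y → (∀ ρ → ρ ∈ R → α ｛ ρ ｝ ≤ᴬ y) → α R ≤ᴬ y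
    α-lub R y h = Equivalence.to (galois R y) λ ρ ρ∈R →
      Equivalence.from (galois ｛ ρ ｝ y) (h ρ ρ∈R) ρ ≈ᴹ-refl

    α-member : ∀ R {ρ} → ρ ∈ R → α ｛ ρ ｝ ≤ᴬ α R
    α-member R ρ∈R = α-mono λ σ σ≈ρ → respects R (≈ᴹ-sym σ≈ρ) ρ∈R

    -- An image is closed under `≈ᴰ`, so its elements are only equivalent to some `apply F ρ`;
    -- monotonicity of `α` reduces the test to these representatives.
    α-image-lub : ∀ F R y → (∀ ρ → ρ ∈ R → α ｛ apply F ρ ｝ ≤ᴬ y) → α (image F R) ≤ᴬ y
    α-image-lub F R y h = α-lub (image F R) y λ where
      σ (ρ , ρ∈R , σ≈Fρ) → ≤ᴬ-trans (α-mono λ _ τ≈σ → ≈ᴹ-trans τ≈σ σ≈Fρ) (h ρ ρ∈R)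

    α-image-member : ∀ F R {ρ} → ρ ∈ R → α ｛ apply F ρ ｝ ≤ᴬ α (image F R)
    α-image-member F R {ρ} ρ∈R = α-member (image F R) {apply F ρ} (ρ , ρ∈R , ≈ᴹ-refl)

    Sound Subsound : Transformer → (Carrier → Carrier) → Set (lsuc 0ℓ ⊔ ℓ₂)
    Sound F f    = IsSoundAbstraction 𝒜 (image F) f
    Subsound F f = ∀ R → f (α R) ≤ᴬ α (image F R)

    infixl 5 _⨾ᶠ_

    _⨾ᶠ_ : (Carrier → Carrier) → (Carrier → Carrier) → Carrier → Carrier
    _⨾ᶠ_ = _⨾♯_ 𝒜

    sound-⨾ : ∀ F G f g → Monotone 𝒜 g → Sound F f → Sound G g → Sound (F ⨾ᵀ G) (f ⨾ᶠ g)
    sound-⨾ F G f g g-mono s t R = ≤ᴬ-trans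
      (α-mono λ _ (ρ , ρ∈R , p) → apply F ρ , (ρ , ρ∈R , ≈ᴹ-refl) , p)
      (≤ᴬ-trans (t (image F R)) (g-mono (s R)))

    subsound-⨾ : ∀ F G f g → Monotone 𝒜 g → Subsound F f → Subsound G g → Subsound (F ⨾ᵀ G) (f ⨾ᶠ g)
    subsound-⨾ F G f g g-mono s t R = ≤ᴬ-trans (g-mono (s R)) (≤ᴬ-trans (t (image F R))
      -- The intermediate state `τ` is only equivalent to `apply F ρ`, so `cong G` is needed to
      -- reach `apply G (apply F ρ)`.
      (α-mono λ _ (τ , (ρ , ρ∈R , p) , q) → ρ , ρ∈R , ≈ᴹ-trans q (cong G p)))

    -- The common form that condition (b) takes for branching and iteration. It speaks of single
    -- states only; the two lemmas below lift it to sets of states.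
    IsJoin : {I : Set} → (I → Transformer) → Transformer → Set ℓ₁
    IsJoin F H = ∀ ρ → α ｛ apply H ρ ｝ ≈ᴬ ⋁ (λ i → α ｛ apply (F i) ρ ｝)

    -- It suffices to bound one state `apply H ρ` at a time. There `join` splits it into the
    -- `apply (F i) ρ`, each of which lies in the image that `s i` controls.
    sound-⋁ : ∀ {I : Set} (F : I → Transformer) H (f : I → Carrier → Carrier) → IsJoin F H →
              (∀ i → Sound (F i) (f i)) → Sound H (λ x → ⋁ λ i → f i x)
    sound-⋁ F H f join s R = α-image-lub H R _ λ ρ ρ∈R →
      ≤ᴬ-trans (≤ᴬ-reflexive (join ρ)) (⋁-least _ _ λ i →
        ≤ᴬ-trans (α-image-member (F i) R ρ∈R) (≤ᴬ-trans (s i R) (⋁-upper (λ i → f i (α R)) i)))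

    -- Read from right to left, `join` puts each `α ｛ apply (F i) ρ ｝` below `α ｛ apply H ρ ｝`, so
    -- the image under `H` dominates the image under every `F i`.
    subsound-⋁ : ∀ {I : Set} (F : I → Transformer) H (f : I → Carrier → Carrier) → IsJoin F H →
                 (∀ i → Subsound (F i) (f i)) → Subsound H (λ x → ⋁ λ i → f i x)
    subsound-⋁ F H f join s R = ⋁-least _ _ λ i →
      ≤ᴬ-trans (s i R) (α-image-lub (F i) R _ λ ρ ρ∈R →
        ≤ᴬ-trans (⋁-upper (λ i → α ｛ apply (F i) ρ ｝) i)
          (≤ᴬ-trans (≤ᴬ-reflexive (≈ᴬ.sym (join ρ))) (α-image-member H R ρ∈R)))

    -- Presents the two branches as a finite family, the shape required by `α-∑`.
    pair : ∀ {b} {B : Set b} → B → B → Fin 2 → B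
    pair x y zero    = x
    pair x y (suc _) = y

    sum-isJoin : ∀ F G F+G≤1 → IsJoin (pair F G) (sumᵀ F G F+G≤1)
    sum-isJoin F G F+G≤1 ρ = α-∑ (λ i → apply (pair F G i) ρ) (λ _ → ℝ.1#) (λ _ → 0<1)
      (apply (sumᵀ F G F+G≤1) ρ)
      (entrywise λ x y → +-cong (at (1·-identity (apply F ρ)) x y)
        -- The finite sum over `Fin 2` unfolds to `a + (b + 0#)`, hence the trailing zero to remove.
        (trans (at (1·-identity (apply G ρ)) x y) (sym (+-identityʳ _))))

    sound-∨ : ∀ F G F+G≤1 f g → Sound F f → Sound G g → Sound (sumᵀ F G F+G≤1) (λ x → f x ∨ g x)
    sound-∨ F G F+G≤1 f g s t R = ≤ᴬ-trans
      (sound-⋁ (pair F G) (sumᵀ F G F+G≤1) (pair f g) (sum-isJoin F G F+G≤1) (λ { zero → s ; (suc _) → t }) R)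
      -- The binary `∨` and the join over `Fin 2` are separate operations, compared through their
      -- universal properties.
      (⋁-least (λ i → pair f g i (α R)) _ λ { zero → x≤x∨y _ _ ; (suc _) → y≤x∨y _ _ })

    subsound-∨ : ∀ F G F+G≤1 f g → Subsound F f → Subsound G g → Subsound (sumᵀ F G F+G≤1) (λ x → f x ∨ g x)
    subsound-∨ F G F+G≤1 f g s t R = ≤ᴬ-trans
      (∨-least (⋁-upper (λ i → pair f g i (α R)) zero) (⋁-upper (λ i → pair f g i (α R)) (suc zero)))
      (subsound-⋁ (pair F G) (sumᵀ F G F+G≤1) (pair f g) (sum-isJoin F G F+G≤1) (λ { zero → s ; (suc _) → t }) R)

    monotone-power : ∀ e f → Monotone 𝒜 e → Monotone 𝒜 f → ∀ i → Monotone 𝒜 (power e _⨾ᶠ_ f i)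
    monotone-power e f e-mono f-mono zero          x≤y = e-mono x≤y
    monotone-power e f e-mono f-mono (suc zero)    x≤y = f-mono x≤y
    monotone-power e f e-mono f-mono (suc (suc i)) x≤y = f-mono (monotone-power e f e-mono f-mono (suc i) x≤y)

    -- `E` and `e` stand for the two meanings of `skip`. The zeroth power is the abstract `skip`,
    -- which need not be the identity, so its own soundness is assumed.
    sound-power : ∀ E F e f → Monotone 𝒜 f → Sound E e → Sound F f →
                  ∀ i → Sound (power E _⨾ᵀ_ F i) (power e _⨾ᶠ_ f i)
    sound-power E F e f f-mono s t zero          = s
    sound-power E F e f f-mono s t (suc zero)    = t
    sound-power E F e f f-mono s t (suc (suc i)) =
      sound-⨾ (power E _⨾ᵀ_ F (suc i)) F (power e _⨾ᶠ_ f (suc i)) f f-mono (sound-power E F e f f-mono s t (suc i)) t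

    subsound-power : ∀ E F e f → Monotone 𝒜 f → Subsound E e → Subsound F f →
                     ∀ i → Subsound (power E _⨾ᵀ_ F i) (power e _⨾ᶠ_ f i)
    subsound-power E F e f f-mono s t zero          = s
    subsound-power E F e f f-mono s t (suc zero)    = t
    subsound-power E F e f f-mono s t (suc (suc i)) =
      subsound-⨾ (power E _⨾ᵀ_ F (suc i)) F (power e _⨾ᶠ_ f (suc i)) f f-mono (subsound-power E F e f f-mono s t (suc i)) t

    series-isJoin : ∀ B E B+E≤1 →
                    IsJoin (λ i → power ⟦ skip ⟧ᵇ _⨾ᵀ_ B i ⨾ᵀ E) (Iteration.series B E B+E≤1)
    series-isJoin B E B+E≤1 ρ = α-∑∞ (λ i → apply (B^ i ⨾ᵀ E) ρ) (λ _ → ℝ.1#) (λ _ → 0<1) (apply series ρ)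
      (IsSum-cong (λ i → 1·-identity (apply (B^ i ⨾ᵀ E) ρ)) (series-isSum ρ))
      where open Iteration B E B+E≤1

    sound-series : ∀ B E B+E≤1 s b e → Monotone 𝒜 b → Monotone 𝒜 e → Sound ⟦ skip ⟧ᵇ s → Sound B b → Sound E e →
                   Sound (Iteration.series B E B+E≤1) (λ x → ⋁ λ i → (power s _⨾ᶠ_ b i ⨾ᶠ e) x)
    sound-series B E B+E≤1 s b e b-mono e-mono hs hb he =
      sound-⋁ (λ i → power ⟦ skip ⟧ᵇ _⨾ᵀ_ B i ⨾ᵀ E) (Iteration.series B E B+E≤1) (λ i → power s _⨾ᶠ_ b i ⨾ᶠ e)
        (series-isJoin B E B+E≤1)
        λ i → sound-⨾ (power ⟦ skip ⟧ᵇ _⨾ᵀ_ B i) E (power s _⨾ᶠ_ b i) e e-mono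
                (sound-power ⟦ skip ⟧ᵇ B s b b-mono hs hb i) he

    subsound-series : ∀ B E B+E≤1 s b e → Monotone 𝒜 b → Monotone 𝒜 e →
                      Subsound ⟦ skip ⟧ᵇ s → Subsound B b → Subsound E e →
                      Subsound (Iteration.series B E B+E≤1) (λ x → ⋁ λ i → (power s _⨾ᶠ_ b i ⨾ᶠ e) x)
    subsound-series B E B+E≤1 s b e b-mono e-mono hs hb he =
      subsound-⋁ (λ i → power ⟦ skip ⟧ᵇ _⨾ᵀ_ B i ⨾ᵀ E) (Iteration.series B E B+E≤1) (λ i → power s _⨾ᶠ_ b i ⨾ᶠ e)
        (series-isJoin B E B+E≤1)
        λ i → subsound-⨾ (power ⟦ skip ⟧ᵇ _⨾ᵀ_ B i) E (power s _⨾ᶠ_ b i) e e-mono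
                (subsound-power ⟦ skip ⟧ᵇ B s b b-mono hs hb i) he

    module _ (⟦_⟧ᵇ♯ : BasicCommand → Carrier → Carrier) (basic-mono : ∀ e → Monotone 𝒜 ⟦ e ⟧ᵇ♯) where
      open AbstractSemantics 𝒜 ⟦_⟧ᵇ♯

      -- Composition applies the second operator to an inequality about the first, so every program,
      -- not only a basic command, must be monotone.
      monotone : ∀ S → Monotone 𝒜 ⟦ S ⟧♯
      monotone (basic e) = basic-mono e
      monotone (S₀ ⨾ S₁) x≤y = monotone S₁ (monotone S₀ x≤y)
      monotone if P [ q̄ ]then S₁ else S₀ end x≤y = ∨-least
        (≤ᴬ-trans (monotone S₁ (basic-mono (assert P [ q̄ ]) x≤y)) (x≤x∨y _ _))
        (≤ᴬ-trans (monotone S₀ (basic-mono (assert P ᗮ [ q̄ ]) x≤y)) (y≤x∨y _ _))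
      monotone while P [ q̄ ]do S end {y = y} x≤y = ⋁-least _ _ λ i → ≤ᴬ-trans
        (basic-mono (assert P ᗮ [ q̄ ])
          (monotone-power ⟦ skip ⟧ᵇ♯ b (basic-mono skip) (λ p → monotone S (basic-mono (assert P [ q̄ ]) p)) i x≤y))
        (⋁-upper (λ i → ⟦ assert P ᗮ [ q̄ ] ⟧ᵇ♯ (power ⟦ skip ⟧ᵇ♯ _⨾ᶠ_ b i y)) i)
        where
        b = ⟦ assert P [ q̄ ] ⟧ᵇ♯ ⨾ᶠ ⟦ S ⟧♯

      sound : (∀ e → Sound ⟦ e ⟧ᵇ ⟦ e ⟧ᵇ♯) → ∀ S → Sound ⟦ S ⟧ ⟦ S ⟧♯
      -- Guarded programs are treated apart because `basic (assert P [ q̄ ]) ⨾ S` is not a subterm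
      -- of the conditional or loop; here the recursion is on `S` itself.
      sound-guard : (∀ e → Sound ⟦ e ⟧ᵇ ⟦ e ⟧ᵇ♯) → ∀ {t} (P : Subspace t) q̄ S →
                    Sound (⟦ assert P [ q̄ ] ⟧ᵇ ⨾ᵀ ⟦ S ⟧) (⟦ assert P [ q̄ ] ⟧ᵇ♯ ⨾ᶠ ⟦ S ⟧♯)

      sound h (basic e) = h e
      sound h (S₀ ⨾ S₁) = sound-⨾ ⟦ S₀ ⟧ ⟦ S₁ ⟧ ⟦ S₀ ⟧♯ ⟦ S₁ ⟧♯ (monotone S₁) (sound h S₀) (sound h S₁)
      sound h if P [ q̄ ]then S₁ else S₀ end = sound-∨
        (⟦ assert P [ q̄ ] ⟧ᵇ ⨾ᵀ ⟦ S₁ ⟧) (⟦ assert P ᗮ [ q̄ ] ⟧ᵇ ⨾ᵀ ⟦ S₀ ⟧) (assert-complementary P q̄ ⟦ S₁ ⟧ ⟦ S₀ ⟧)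
        (⟦ assert P [ q̄ ] ⟧ᵇ♯ ⨾ᶠ ⟦ S₁ ⟧♯) (⟦ assert P ᗮ [ q̄ ] ⟧ᵇ♯ ⨾ᶠ ⟦ S₀ ⟧♯)
        (sound-guard h P q̄ S₁) (sound-guard h (P ᗮ) q̄ S₀)
      sound h while P [ q̄ ]do S end = sound-series
        -- The trace condition treats the exit as followed by `skip`, which acts as `id`; it is the
        -- same witness as in the definition of the loop's semantics.
        (⟦ assert P [ q̄ ] ⟧ᵇ ⨾ᵀ ⟦ S ⟧) ⟦ assert P ᗮ [ q̄ ] ⟧ᵇ (assert-complementary P q̄ ⟦ S ⟧ ⟦ skip ⟧ᵇ)
        ⟦ skip ⟧ᵇ♯ (⟦ assert P [ q̄ ] ⟧ᵇ♯ ⨾ᶠ ⟦ S ⟧♯) ⟦ assert P ᗮ [ q̄ ] ⟧ᵇ♯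
        (λ p → monotone S (basic-mono (assert P [ q̄ ]) p)) (basic-mono (assert P ᗮ [ q̄ ]))
        (h skip) (sound-guard h P q̄ S) (h (assert P ᗮ [ q̄ ]))

      sound-guard h P q̄ S = sound-⨾ ⟦ assert P [ q̄ ] ⟧ᵇ ⟦ S ⟧ ⟦ assert P [ q̄ ] ⟧ᵇ♯ ⟦ S ⟧♯
        (monotone S) (h (assert P [ q̄ ])) (sound h S)

      subsound : (∀ e → Subsound ⟦ e ⟧ᵇ ⟦ e ⟧ᵇ♯) → ∀ S → Subsound ⟦ S ⟧ ⟦ S ⟧♯
      subsound-guard : (∀ e → Subsound ⟦ e ⟧ᵇ ⟦ e ⟧ᵇ♯) → ∀ {t} (P : Subspace t) q̄ S →
                       Subsound (⟦ assert P [ q̄ ] ⟧ᵇ ⨾ᵀ ⟦ S ⟧) (⟦ assert P [ q̄ ] ⟧ᵇ♯ ⨾ᶠ ⟦ S ⟧♯)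

      subsound h (basic e) = h e
      subsound h (S₀ ⨾ S₁) = subsound-⨾ ⟦ S₀ ⟧ ⟦ S₁ ⟧ ⟦ S₀ ⟧♯ ⟦ S₁ ⟧♯ (monotone S₁) (subsound h S₀) (subsound h S₁)
      subsound h if P [ q̄ ]then S₁ else S₀ end = subsound-∨
        (⟦ assert P [ q̄ ] ⟧ᵇ ⨾ᵀ ⟦ S₁ ⟧) (⟦ assert P ᗮ [ q̄ ] ⟧ᵇ ⨾ᵀ ⟦ S₀ ⟧) (assert-complementary P q̄ ⟦ S₁ ⟧ ⟦ S₀ ⟧)
        (⟦ assert P [ q̄ ] ⟧ᵇ♯ ⨾ᶠ ⟦ S₁ ⟧♯) (⟦ assert P ᗮ [ q̄ ] ⟧ᵇ♯ ⨾ᶠ ⟦ S₀ ⟧♯)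
        (subsound-guard h P q̄ S₁) (subsound-guard h (P ᗮ) q̄ S₀)
      subsound h while P [ q̄ ]do S end = subsound-series
        (⟦ assert P [ q̄ ] ⟧ᵇ ⨾ᵀ ⟦ S ⟧) ⟦ assert P ᗮ [ q̄ ] ⟧ᵇ (assert-complementary P q̄ ⟦ S ⟧ ⟦ skip ⟧ᵇ)
        ⟦ skip ⟧ᵇ♯ (⟦ assert P [ q̄ ] ⟧ᵇ♯ ⨾ᶠ ⟦ S ⟧♯) ⟦ assert P ᗮ [ q̄ ] ⟧ᵇ♯
        (λ p → monotone S (basic-mono (assert P [ q̄ ]) p)) (basic-mono (assert P ᗮ [ q̄ ]))
        (h skip) (subsound-guard h P q̄ S) (h (assert P ᗮ [ q̄ ]))

      subsound-guard h P q̄ S = subsound-⨾ ⟦ assert P [ q̄ ] ⟧ᵇ ⟦ S ⟧ ⟦ assert P [ q̄ ] ⟧ᵇ♯ ⟦ S ⟧♯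
        (monotone S) (h (assert P [ q̄ ])) (subsound h S)

      complete : (∀ e → IsCompleteAbstraction 𝒜 (image ⟦ e ⟧ᵇ) ⟦ e ⟧ᵇ♯) →
                 ∀ S → IsCompleteAbstraction 𝒜 (image ⟦ S ⟧) ⟦ S ⟧♯
      complete h S R = antisym
        (sound (λ e R → ≤ᴬ-reflexive (h e R)) S R)
        (subsound (λ e R → ≤ᴬ-reflexive (≈ᴬ.sym (h e R))) S R)

mainTheorem5 : ∀ {a ℓ₁ ℓ₂ : Level} (em : ExcludedMiddle 0ℓ) (ℝ : CompleteOrderedField) (n : ℕ) →
    let open AbstractInterpretation em ℝ n in
    (𝒜 : WellStructuredDomain a ℓ₁ ℓ₂) →
    let open WellStructuredDomain 𝒜 in
    (⟦_⟧ᵇ♯ : BasicCommand → Carrier → Carrier) →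
    (∀ e → Monotone 𝒜 ⟦ e ⟧ᵇ♯) →
    let open AbstractSemantics 𝒜 ⟦_⟧ᵇ♯ in
    ((∀ e → IsSoundAbstraction 𝒜 (image ⟦ e ⟧ᵇ) ⟦ e ⟧ᵇ♯) →
    ∀ S → IsSoundAbstraction 𝒜 (image ⟦ S ⟧) ⟦ S ⟧♯)
    ×
    ((∀ e → IsCompleteAbstraction 𝒜 (image ⟦ e ⟧ᵇ) ⟦ e ⟧ᵇ♯) →
    ∀ S → IsCompleteAbstraction 𝒜 (image ⟦ S ⟧) ⟦ S ⟧♯)
mainTheorem5 em ℝ n 𝒜 ⟦_⟧ᵇ♯ mono = sound em ℝ n 𝒜 ⟦_⟧ᵇ♯ mono , complete em ℝ n 𝒜 ⟦_⟧ᵇ♯ mono
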